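{- Let $p$ be an odd prime and $m>1$. Let $\alpha$ be a primitive element of $GF(p^{2m})$, let $\omega=\alpha^{p^m+1}$ (a primitive element of $GF(p^m)$), and let $e=\frac{p^m-1}{p-1}$. Let $D=\{i \in \{0,1,\ldots,e-1\} : Tr_{m/1}(\omega^i)=0\}$, regarded as a subset of $\mathbb{Z}_e$ (this is a $(\frac{p^m-1}{p-1},\frac{p^{m-1}-1}{p-1},\frac{p^{m-2}-1}{p-1})$ Singer difference set in $(\mathbb{Z}_e,+)$). For $0 \leq i \leq e-1$ let $C_i^{e,2m}=\alpha^i\langle\alpha^e\rangle$ be the $i$-th cyclotomic class of order $e$ in $GF(p^{2m})$. Then (i) $X=\bigcup_{j \in D} C_j^{e,2m}$ is a regular $(p^{2m},\ p^{2m-1}-p^{m-1}(p-1)-1,\ p^{2m-2}-p^{m-1}(p-1)-2,\ p^{2m-2}-p^{m-1})$-partial difference set in the additive group of $GF(p^{2m})$; (ii) $X=\{x \in GF(p^{2m}) \setminus \{0\} : Tr_{m/1}(x^{p^m+1})=0\}$.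
   Context: $Tr_{m/1}(y)=y+y^p+\cdots+y^{p^{m-1}}$ is the trace map from $GF(p^m)$ to $GF(p)$. A $k$-subset $S$ of a finite additive group $G$ of order $v$ is a $(v,k,\lambda,\mu)$ partial difference set if the multiset $\{s_1-s_2: s_1,s_2 \in S\}$ contains every element of $S\setminus\{0\}$ exactly $\lambda$ times and every element of $G \setminus (S \cup\{0\})$ exactly $\mu$ times; it is regular if $S=-S$ and $0 \notin S$. -}

module Defs where

open import Level using (0ℓ)
open import Algebra.Bundles using (CommutativeRing)
open import Data.Nat using (ℕ; zero; suc)
import Data.Nat as N
open import Data.Fin using (Fin)
open import Data.Bool using (Bool; true; false; _∧_; _∨_; if_then_else_)
open import Data.Product using (_×_; ∃)
open import Relation.Nullary using (¬_; does)
open import Relation.Binary using (Decidable)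
open import Relation.Binary.PropositionalEquality using (_≡_)

anyBelow : ℕ → (ℕ → Bool) → Bool
anyBelow zero f = false
anyBelow (suc n) f = f n ∨ anyBelow n f

countFin : ∀ {n} → (Fin n → Bool) → ℕ
countFin {zero} P = 0
countFin {suc n} P = (if P Fin.zero then 1 else 0) N.+ countFin (λ i → P (Fin.suc i))

sumFin : ∀ {n} → (Fin n → ℕ) → ℕ
sumFin {zero} f = 0
sumFin {suc n} f = f Fin.zero N.+ sumFin (λ i → f (Fin.suc i))

module _ (R : CommutativeRing 0ℓ 0ℓ) where
  open CommutativeRing R

  pow : Carrier → ℕ → Carrier
  pow x zero = 1#
  pow x (suc n) = x * pow x n

  sumBelow : ℕ → (ℕ → Carrier) → Carrier
  sumBelow zero f = 0#
  sumBelow (suc n) f = sumBelow n f + f n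

  trace : ℕ → ℕ → Carrier → Carrier
  trace p m y = sumBelow m (λ i → pow y (p N.^ i))

  record IsFiniteFieldOfOrder (q : ℕ) : Set where
    field
      _≟_       : Decidable _≈_
      enum      : Fin q → Carrier
      enum-surj : ∀ x → ∃ λ i → enum i ≈ x
      enum-inj  : ∀ i j → enum i ≈ enum j → i ≡ j
      1≉0       : ¬ (1# ≈ 0#)
      inverse   : ∀ x → ¬ (x ≈ 0#) → ∃ λ y → x * y ≈ 1#

  IsPrimitive : ℕ → Carrier → Set
  IsPrimitive q α = (pow α (q N.∸ 1) ≈ 1#) × (∀ k → 0 N.< k → k N.< q N.∸ 1 → ¬ (pow α k ≈ 1#))

  module _ {q : ℕ} (F : IsFiniteFieldOfOrder q) where
    open IsFiniteFieldOfOrder F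

    size : (Carrier → Bool) → ℕ
    size S = countFin (λ i → S (enum i))

    diffCount : (Carrier → Bool) → Carrier → ℕ
    diffCount S d = sumFin (λ i → countFin (λ j →
      S (enum i) ∧ S (enum j) ∧ does ((enum i + - enum j) ≟ d)))

    IsRegularPDS : (Carrier → Bool) → ℕ → ℕ → ℕ → ℕ → Set
    IsRegularPDS S v k lam mu =
      (v ≡ q) × (size S ≡ k)
      × (∀ d → ¬ (d ≈ 0#) → S d ≡ true → diffCount S d ≡ lam)
      × (∀ d → ¬ (d ≈ 0#) → S d ≡ false → diffCount S d ≡ mu)
      × (∀ x → S (- x) ≡ S x) × (S 0# ≡ false)

    inD : ℕ → ℕ → Carrier → ℕ → Bool
    inD p m α j = does (trace p m (pow (pow α (p N.^ m N.+ 1)) j) ≟ 0#)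

    -- x ∈ X = ⋃_{j ∈ D} C_j^{e,2m},  C_j = α^j ⟨α^e⟩ = { α^(j + e k) : 0 ≤ k < p^(2m) - 1 }
    inX : ℕ → ℕ → Carrier → ℕ → Carrier → Bool
    inX p m α e x = anyBelow e (λ j → inD p m α j ∧
      anyBelow (p N.^ (2 N.* m) N.∸ 1) (λ k → does (x ≟ pow α (j N.+ e N.* k))))

{-# OPTIONS --safe #-}
module Submission where

-- X consists of the nonzero zeros of the quadratic form Q(x) = Tr(x^(p^m+1)), with polar form B. The number of zeros
-- of Q follows from the fibres of the norm and of the trace on GF(p^m). For d ≠ 0 let N(c) be the number of y with
-- Q(y) = 0 and B(y,d) = c. Replacing y by y + d turns the differences equal to d into the y with Q(y) = 0 and
-- B(y,d) = −Q(d), so that N(−Q(d)) is wanted. Scaling shows that N is constant on nonzero c, hence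
-- N(0) + (p−1) N(1) is the number of zeros of Q and one further value is enough. If Q(d) = 0, translation along d
-- gives N(1) = p^(2m−2). If Q(d) ≠ 0, the same translation argument for the form Q(y) − Q(d) x² in one more
-- variable, where (d , 1) is isotropic, gives N(0) = p^(2m−2).

open import Defs
open import Level using (0ℓ)
open import Algebra.Bundles using (CommutativeRing)
open import Data.Nat using (ℕ; zero; suc; _+_; _*_; _∸_; _^_; _<_; s<s; z<s; NonZero; >-nonZero; ≢-nonZero; nonTrivial⇒n>1)
open import Data.Nat.Properties hiding (_≟_)
open import Data.Nat.DivMod using (_%_; _/_; m≡m%n+[m/n]*n; m%n<n; m/n≤m)
open import Data.Nat.Divisibility using (_∣_; divides; ∣⇒≤; ∣-refl; m∣m*n; n∣m*n; *-cancelʳ-∣; ∣m+n∣m⇒∣n)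
open import Data.Nat.Primality using (Prime; euclidsLemma; prime⇒nonZero; prime⇒nonTrivial)
open import Data.Nat.Combinatorics using (_C_; nCn≡1; nC1≡n; nCk+nC[k+1]≡[n+1]C[k+1]; k>n⇒nCk≡0)
open import Data.Nat.Tactic.RingSolver using (solve-∀)
open import Data.Bool using (Bool; true; false; if_then_else_; _∧_)
open import Data.Bool.Properties using (⇔→≡)
open import Data.Fin using (Fin; toℕ; fromℕ; fromℕ<; inject₁; punchIn)
open import Data.Fin.Properties using (punchInᵢ≢i; toℕ-fromℕ; toℕ-inject₁; toℕ<n; toℕ-fromℕ<; toℕ-injective; any?; pigeonhole; ¬∀⟶∃¬)
open import Data.Fin.Permutation using (permutation)
open import Data.Product using (_×_; _,_; ∃; proj₁; proj₂)
open import Data.Sum using (inj₁; inj₂)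
open import Function using (_∘_)
open import Function.Bundles using (_⇔_; mk⇔; Equivalence)
open import Relation.Nullary using (¬_; Dec; yes; no; does; contradiction)
open import Relation.Nullary.Decidable using (does-⇔; dec-true; dec-false)
open import Relation.Binary.Definitions using (tri<; tri≈; tri>)
open import Relation.Binary.PropositionalEquality
  using (_≡_; _≢_; refl; sym; trans; cong; cong₂; subst; module ≡-Reasoning)
import Algebra.Properties.Semiring.Sum as SemiringSum
import Algebra.Properties.Semiring.Mult as SemiringMult
import Algebra.Properties.CommutativeSemiring.Exp as SemiringExp
import Algebra.Properties.CommutativeSemiring.Binomial as Binomial
import Algebra.Properties.Ring as RingProperties
import Algebra.Solver.Ring.NaturalCoefficients.Default as SemiringSolver
import Relation.Binary.Reasoning.Setoid as SetoidReasoning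

open SemiringSum +-*-semiring using
  (sum; sum-cong-≗; sum-remove; sum-replicate-zero; ∑-comm; ∑-distrib-+; *-distribˡ-sum; *-distribʳ-sum)

-- No character sums enter; one device replaces them. A map `T` into GF(p) with T(x + c t) = T(x) +
-- c for all c in GF(p) takes every value equally often on a set that is invariant under translation
-- by the multiples of t. The device is used for the trace on GF(p^m), for the functional B(·,d),
-- for Q on a hyperplane and for the form in one more variable. It yields each count multiplied by
-- p, and identities between counts stay additive in ℕ until the parameters are read off, where
-- truncated subtraction of counts is harmless. The obstacle is a d with Q(d) ≠ 0: translation by l
-- d changes Q by l B(y,d) + l² Q(d), which is not linear in l. The additional variable absorbs the
-- quadratic term. GF(p) and GF(p^m) are not built as separate fields. They are the solution sets of
-- x^p = x and x^(p^m) = x inside GF(p^(2m)), where the powers of `α` enumerate them.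

-- Finite sums of natural numbers

⟦_⟧ : Bool → ℕ
⟦ b ⟧ = if b then 1 else 0

⟦∧⟧ : ∀ a b → ⟦ a ∧ b ⟧ ≡ ⟦ a ⟧ * ⟦ b ⟧
⟦∧⟧ true  b = sym (+-identityʳ ⟦ b ⟧)
⟦∧⟧ false b = refl

sumFin≡sum : ∀ {n} (f : Fin n → ℕ) → sumFin f ≡ sum f
sumFin≡sum {zero}  f = refl
sumFin≡sum {suc n} f = cong (f Fin.zero +_) (sumFin≡sum (f ∘ Fin.suc))

countFin≡sum : ∀ {n} (P : Fin n → Bool) → countFin P ≡ sum (⟦_⟧ ∘ P)
countFin≡sum {zero}  P = refl
countFin≡sum {suc n} P = cong (⟦ P Fin.zero ⟧ +_) (countFin≡sum (P ∘ Fin.suc))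

sum-zero : ∀ {n} (f : Fin n → ℕ) → (∀ i → f i ≡ 0) → sum f ≡ 0
sum-zero {n} f f≡0 = trans (sum-cong-≗ f≡0) (sum-replicate-zero n)

sum-const : ∀ n c → sum {n} (λ _ → c) ≡ n * c
sum-const zero    c = refl
sum-const (suc n) c = cong (c +_) (sum-const n c)

sum-single : ∀ {n} (f : Fin n → ℕ) i₀ → (∀ i → i ≢ i₀ → f i ≡ 0) → sum f ≡ f i₀
sum-single {suc n} f i₀ off = begin
  sum f                              ≡⟨ sum-remove {i = i₀} f ⟩
  f i₀ + sum (λ j → f (punchIn i₀ j)) ≡⟨ cong (f i₀ +_) (sum-zero _ (λ j → off _ (λ eq → punchInᵢ≢i i₀ j eq))) ⟩
  f i₀ + 0                           ≡⟨ +-identityʳ _ ⟩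
  f i₀                               ∎
  where open ≡-Reasoning

∑< : ℕ → (ℕ → ℕ) → ℕ
∑< n f = sum {n} (f ∘ toℕ)

∑<-cong : ∀ n {f g : ℕ → ℕ} → (∀ k → f k ≡ g k) → ∑< n f ≡ ∑< n g
∑<-cong n f≗g = sum-cong-≗ {n} (f≗g ∘ toℕ)

∑<-+ : ∀ m n f → ∑< (m + n) f ≡ ∑< m f + ∑< n (λ k → f (m + k))
∑<-+ zero    n f = refl
∑<-+ (suc m) n f = trans (cong (f 0 +_) (∑<-+ m n (f ∘ suc))) (sym (+-assoc (f 0) _ _))

∑<-* : ∀ m n f → ∑< (m * n) f ≡ ∑< m (λ j → ∑< n (λ i → f (j * n + i)))
∑<-* zero    n f = refl
∑<-* (suc m) n f = begin
  ∑< (n + m * n) f                                                    ≡⟨ ∑<-+ n (m * n) f ⟩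
  ∑< n f + ∑< (m * n) (λ k → f (n + k))                               ≡⟨ cong (∑< n f +_) (∑<-* m n (λ k → f (n + k))) ⟩
  ∑< n f + ∑< m (λ j → ∑< n (λ i → f (n + (j * n + i))))
    ≡⟨ cong (∑< n f +_) (∑<-cong m (λ j → ∑<-cong n (λ i → cong f (+-assoc n (j * n) i)))) ⟨
  ∑< (suc m) (λ j → ∑< n (λ i → f (j * n + i)))                       ∎
  where open ≡-Reasoning

-- Binomial coefficients divisible by a prime

[k+1]*[n+1]C[k+1]≡[n+1]*nCk : ∀ n k → suc k * (suc n C suc k) ≡ suc n * (n C k)
[k+1]*[n+1]C[k+1]≡[n+1]*nCk zero    zero    = refl
[k+1]*[n+1]C[k+1]≡[n+1]*nCk zero    (suc k) =
  trans (cong (suc (suc k) *_) (k>n⇒nCk≡0 {n = 1} (s<s (z<s {k})))) (*-zeroʳ (suc (suc k)))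
[k+1]*[n+1]C[k+1]≡[n+1]*nCk (suc n) zero    =
  trans (*-identityˡ _) (trans (nC1≡n (suc (suc n))) (sym (*-identityʳ (suc (suc n)))))
[k+1]*[n+1]C[k+1]≡[n+1]*nCk (suc n) (suc k) = begin
  suc (suc k) * (suc (suc n) C suc (suc k))
    ≡⟨ cong (suc (suc k) *_) (nCk+nC[k+1]≡[n+1]C[k+1] (suc n) (suc k)) ⟨
  suc (suc k) * (c + suc n C suc (suc k))
    ≡⟨ *-distribˡ-+ (suc (suc k)) c _ ⟩
  (c + suc k * c) + suc (suc k) * (suc n C suc (suc k))
    ≡⟨ cong₂ _+_ (cong (c +_) ([k+1]*[n+1]C[k+1]≡[n+1]*nCk n k)) ([k+1]*[n+1]C[k+1]≡[n+1]*nCk n (suc k)) ⟩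
  (c + suc n * (n C k)) + suc n * (n C suc k)
    ≡⟨ trans (+-assoc c _ _) (cong (c +_) (sym (*-distribˡ-+ (suc n) (n C k) _))) ⟩
  c + suc n * (n C k + n C suc k)
    ≡⟨ cong (λ z → c + suc n * z) (nCk+nC[k+1]≡[n+1]C[k+1] n k) ⟩
  suc (suc n) * c ∎
  where
  open ≡-Reasoning
  c = suc n C suc k

-- By the absorption identity the prime divides the product of `suc k` and the coefficient, and
-- `suc k` is too small to be divisible by it.
prime∣pC[k+1] : ∀ {p k} → Prime (suc p) → suc k < suc p → suc p ∣ (suc p C suc k)
prime∣pC[k+1] {p} {k} pr k<p with euclidsLemma (suc k) (suc p C suc k) pr
  (subst (suc p ∣_) (sym ([k+1]*[n+1]C[k+1]≡[n+1]*nCk p k)) (m∣m*n (p C k)))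
... | inj₁ p∣k = contradiction (∣⇒≤ p∣k) (<⇒≱ k<p)
... | inj₂ p∣C = p∣C

-- Counting in a finite field and its cyclic multiplicative group

module FiniteField {R : CommutativeRing 0ℓ 0ℓ} {q : ℕ} (F : IsFiniteFieldOfOrder R q) where
  open CommutativeRing R public
    using (Carrier; _≈_; 0#; 1#; setoid)
    renaming (_+_ to _⊕_; _*_ to _⊗_; -_ to ⊖_; refl to ≈-refl; sym to ≈-sym; trans to ≈-trans)
  open IsFiniteFieldOfOrder F public

  Congruent : (Carrier → ℕ) → Set
  Congruent f = ∀ {x y} → x ≈ y → f x ≡ f y

  index : Carrier → Fin q
  index x = proj₁ (enum-surj x)

  enum-index : ∀ x → enum (index x) ≈ x
  enum-index x = proj₂ (enum-surj x)

  δ : Carrier → Carrier → ℕ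
  δ x y = ⟦ does (x ≟ y) ⟧

  δ-⇔ : ∀ {x y x′ y′} → (x ≈ y → x′ ≈ y′) → (x′ ≈ y′ → x ≈ y) → δ x y ≡ δ x′ y′
  δ-⇔ f g = cong ⟦_⟧ (does-⇔ (mk⇔ f g) (_ ≟ _) (_ ≟ _))

  δ-cong : ∀ {x y x′ y′} → x ≈ x′ → y ≈ y′ → δ x y ≡ δ x′ y′
  δ-cong p r = δ-⇔ (λ e → ≈-trans (≈-sym p) (≈-trans e r)) (λ e → ≈-trans p (≈-trans e (≈-sym r)))

  δ-congˡ : ∀ {x y y′} → y ≈ y′ → δ x y ≡ δ x y′
  δ-congˡ = δ-cong ≈-refl

  δ-congʳ : ∀ {x x′ y} → x ≈ x′ → δ x y ≡ δ x′ y
  δ-congʳ p = δ-cong p ≈-refl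

  δ-yes : ∀ {x y} → x ≈ y → δ x y ≡ 1
  δ-yes e = cong ⟦_⟧ (dec-true (_ ≟ _) e)

  δ-no : ∀ {x y} → ¬ (x ≈ y) → δ x y ≡ 0
  δ-no e = cong ⟦_⟧ (dec-false (_ ≟ _) e)

  δ≢0 : ∀ {x y} → δ x y ≢ 0 → x ≈ y
  δ≢0 {x} {y} nz with x ≟ y
  ... | yes e = e
  ... | no  _ = contradiction refl nz

  δ-sym : ∀ {x y} → δ x y ≡ δ y x
  δ-sym = δ-⇔ ≈-sym ≈-sym

  ∑ : (Carrier → ℕ) → ℕ
  ∑ f = sum (f ∘ enum)

  ∑-cong : ∀ {f g} → (∀ x → f x ≡ g x) → ∑ f ≡ ∑ g
  ∑-cong f≗g = sum-cong-≗ (f≗g ∘ enum)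

  ∑-+ : ∀ f g → ∑ (λ x → f x + g x) ≡ ∑ f + ∑ g
  ∑-+ f g = ∑-distrib-+ (f ∘ enum) (g ∘ enum)

  ∑-*ˡ : ∀ c f → ∑ (λ x → c * f x) ≡ c * ∑ f
  ∑-*ˡ c f = sym (*-distribˡ-sum c (f ∘ enum))

  ∑-swap : ∀ (f : Carrier → Carrier → ℕ) → ∑ (λ x → ∑ (λ y → f x y)) ≡ ∑ (λ y → ∑ (λ x → f x y))
  ∑-swap f = ∑-comm (λ i j → f (enum i) (enum j))

  ∑-one : ∑ (λ _ → 1) ≡ q
  ∑-one = trans (sum-const q 1) (*-identityʳ q)

  ∑-δ : ∀ a {f} → Congruent f → ∑ (λ x → δ x a * f x) ≡ f a
  ∑-δ a {f} f-cong = begin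
    ∑ (λ x → δ x a * f x)
      ≡⟨ sum-single _ (index a) (λ i i≢ → cong (_* f (enum i)) (δ-no (λ e → i≢ (enum-inj i _ (≈-trans e (≈-sym (enum-index a))))))) ⟩
    δ (enum (index a)) a * f (enum (index a))
      ≡⟨ cong₂ _*_ (δ-yes (enum-index a)) (f-cong (enum-index a)) ⟩
    1 * f a ≡⟨ *-identityˡ (f a) ⟩
    f a ∎
    where open ≡-Reasoning

  ∑-δ₁ : ∀ a → ∑ (λ x → δ x a) ≡ 1
  ∑-δ₁ a = trans (∑-cong (λ x → sym (*-identityʳ (δ x a)))) (∑-δ a (λ _ → refl))

  -- Expanding `f (φ x)` as a sum of `δ y (φ x) * f y` over y and exchanging the sums leaves the
  -- number of x with `x ≈ ψ y`, which is 1. The bijection thus acts on field elements up to `≈`,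
  -- and no permutation of indices has to be constructed.
  ∑-bij : ∀ (φ ψ : Carrier → Carrier) → (∀ {x y} → x ≈ y → φ x ≈ φ y) → (∀ {x y} → x ≈ y → ψ x ≈ ψ y) →
          (∀ x → φ (ψ x) ≈ x) → (∀ x → ψ (φ x) ≈ x) →
          ∀ {f} → Congruent f → ∑ (λ x → f (φ x)) ≡ ∑ f
  ∑-bij φ ψ φ-cong ψ-cong φψ ψφ {f} f-cong = begin
    ∑ (λ x → f (φ x))                     ≡⟨ ∑-cong (λ x → ∑-δ (φ x) f-cong) ⟨
    ∑ (λ x → ∑ (λ y → δ y (φ x) * f y))   ≡⟨ ∑-swap (λ x y → δ y (φ x) * f y) ⟩
    ∑ (λ y → ∑ (λ x → δ y (φ x) * f y))
      ≡⟨ ∑-cong (λ y → ∑-cong (λ x → trans (*-comm _ (f y)) (cong (f y *_) (δ-⇔ (to x y) (from x y))))) ⟩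
    ∑ (λ y → ∑ (λ x → f y * δ x (ψ y)))
      ≡⟨ ∑-cong (λ y → trans (∑-*ˡ (f y) (λ x → δ x (ψ y))) (trans (cong (f y *_) (∑-δ₁ (ψ y))) (*-identityʳ (f y)))) ⟩
    ∑ f                                   ∎
    where
    open ≡-Reasoning
    to : ∀ x y → y ≈ φ x → x ≈ ψ y
    to x y e = ≈-trans (≈-sym (ψφ x)) (ψ-cong (≈-sym e))
    from : ∀ x y → x ≈ ψ y → y ≈ φ x
    from x y e = ≈-trans (≈-sym (φψ y)) (φ-cong (≈-sym e))

  open CommutativeRing R public
    using (ring; semiring; commutativeSemiring)
    renaming ( +-cong to ⊕-cong; +-congˡ to ⊕-congˡ; +-congʳ to ⊕-congʳ; +-assoc to ⊕-assoc; +-comm to ⊕-comm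
             ; +-identityˡ to ⊕-identityˡ; +-identityʳ to ⊕-identityʳ; -‿cong to ⊖-cong
             ; -‿inverseˡ to ⊖-inverseˡ; -‿inverseʳ to ⊖-inverseʳ
             ; *-cong to ⊗-cong; *-congˡ to ⊗-congˡ; *-congʳ to ⊗-congʳ; *-assoc to ⊗-assoc; *-comm to ⊗-comm
             ; *-identityˡ to ⊗-identityˡ; *-identityʳ to ⊗-identityʳ
             ; distribˡ to ⊗-distribˡ-⊕; distribʳ to ⊗-distribʳ-⊕; zeroˡ to ⊗-zeroˡ; zeroʳ to ⊗-zeroʳ
             ; reflexive to ≈-reflexive)
  open RingProperties ring public
    using ()
    renaming (+-cancelˡ to ⊕-cancelˡ; +-cancelʳ to ⊕-cancelʳ
             ; -‿involutive to ⊖-involutive; -0#≈0# to ⊖0≈0; -‿+-comm to ⊖-⊕-comm; -1*x≈-x to ⊖1⊗)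
  module ≈-Reasoning = SetoidReasoning setoid
  module S = SemiringSum semiring
  open SemiringMult semiring public using (×-congʳ; ×-assoc-*; ×1-homo-*) renaming (_×_ to _×ᴿ_)
  private module E = SemiringExp commutativeSemiring
  infixr 8 _↑_
  _↑_ : Carrier → ℕ → Carrier
  _↑_ = pow R

  ↑≡^ : ∀ x n → x ↑ n ≡ x E.^ n
  ↑≡^ x zero    = refl
  ↑≡^ x (suc n) = cong (x ⊗_) (↑≡^ x n)

  ↑-congˡ : ∀ n {x y} → x ≈ y → x ↑ n ≈ y ↑ n
  ↑-congˡ zero    e = ≈-refl
  ↑-congˡ (suc n) e = ⊗-cong e (↑-congˡ n e)

  ↑-congʳ : ∀ x {m n} → m ≡ n → x ↑ m ≈ x ↑ n
  ↑-congʳ x e = ≈-reflexive (cong (x ↑_) e)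

  ↑-+ : ∀ x m n → x ↑ (m + n) ≈ x ↑ m ⊗ x ↑ n
  ↑-+ x m n rewrite ↑≡^ x (m + n) | ↑≡^ x m | ↑≡^ x n = E.^-homo-* x m n

  ↑-* : ∀ x m n → (x ↑ m) ↑ n ≈ x ↑ (m * n)
  ↑-* x m n rewrite ↑≡^ (x ↑ m) n | ↑≡^ x (m * n) | ↑≡^ x m = E.^-assocʳ x m n

  ↑-*′ : ∀ x m n → (x ↑ m) ↑ n ≈ (x ↑ n) ↑ m
  ↑-*′ x m n = ≈-trans (↑-* x m n) (≈-trans (↑-congʳ x (*-comm m n)) (≈-sym (↑-* x n m)))

  ↑-⊗ : ∀ x y n → (x ⊗ y) ↑ n ≈ x ↑ n ⊗ y ↑ n
  ↑-⊗ x y n rewrite ↑≡^ (x ⊗ y) n | ↑≡^ x n | ↑≡^ y n = E.^-distrib-* x y n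

  1↑ : ∀ n → 1# ↑ n ≈ 1#
  1↑ zero    = ≈-refl
  1↑ (suc n) = ≈-trans (⊗-identityˡ _) (1↑ n)

  ↑-1 : ∀ x → x ↑ 1 ≈ x
  ↑-1 x = ⊗-identityʳ x

  ⊗-≈0 : ∀ {x y} → x ⊗ y ≈ 0# → ¬ (x ≈ 0#) → y ≈ 0#
  ⊗-≈0 {x} {y} xy≈0 x≉0 with x⁻¹ , inv ← inverse x x≉0 = begin
    y               ≈⟨ ⊗-identityˡ y ⟨
    1# ⊗ y          ≈⟨ ⊗-congʳ (≈-trans (⊗-comm x⁻¹ x) inv) ⟨
    (x⁻¹ ⊗ x) ⊗ y   ≈⟨ ⊗-assoc x⁻¹ x y ⟩
    x⁻¹ ⊗ (x ⊗ y)   ≈⟨ ⊗-congˡ xy≈0 ⟩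
    x⁻¹ ⊗ 0#        ≈⟨ ⊗-zeroʳ x⁻¹ ⟩
    0#              ∎
    where open ≈-Reasoning

  ⊗-≉0 : ∀ {x y} → ¬ (x ≈ 0#) → ¬ (y ≈ 0#) → ¬ (x ⊗ y ≈ 0#)
  ⊗-≉0 x≉0 y≉0 e = y≉0 (⊗-≈0 e x≉0)

  ↑-≉0 : ∀ {x} n → ¬ (x ≈ 0#) → ¬ (x ↑ n ≈ 0#)
  ↑-≉0 zero    x≉0 = 1≉0
  ↑-≉0 (suc n) x≉0 = ⊗-≉0 x≉0 (↑-≉0 n x≉0)

  ⊗-cancelˡ : ∀ {x y z} → ¬ (x ≈ 0#) → x ⊗ y ≈ x ⊗ z → y ≈ z
  ⊗-cancelˡ {x} {y} {z} x≉0 e = ⊕-cancelʳ (⊖ z) y z (≈-trans (⊗-≈0 x[y-z]≈0 x≉0) (≈-sym (⊖-inverseʳ z)))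
    where
    open ≈-Reasoning
    x[y-z]≈0 : x ⊗ (y ⊕ ⊖ z) ≈ 0#
    x[y-z]≈0 = begin
      x ⊗ (y ⊕ ⊖ z)        ≈⟨ ⊗-distribˡ-⊕ x y (⊖ z) ⟩
      x ⊗ y ⊕ x ⊗ ⊖ z      ≈⟨ ⊕-congʳ e ⟩
      x ⊗ z ⊕ x ⊗ ⊖ z      ≈⟨ ⊗-distribˡ-⊕ x z (⊖ z) ⟨
      x ⊗ (z ⊕ ⊖ z)        ≈⟨ ⊗-congˡ (⊖-inverseʳ z) ⟩
      x ⊗ 0#               ≈⟨ ⊗-zeroʳ x ⟩
      0#                   ∎

  ⊕⊖-cancel : ∀ x y → (x ⊕ y) ⊕ ⊖ y ≈ x
  ⊕⊖-cancel x y = ≈-trans (⊕-assoc x y (⊖ y)) (≈-trans (⊕-congˡ (⊖-inverseʳ y)) (⊕-identityʳ x))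

  ⊖⊕-cancel : ∀ x y → (x ⊕ ⊖ y) ⊕ y ≈ x
  ⊖⊕-cancel x y = ≈-trans (⊕-assoc x (⊖ y) y) (≈-trans (⊕-congˡ (⊖-inverseˡ y)) (⊕-identityʳ x))

  -- Translation by 1 permutes the field, so it does not change the sum of all elements.
  order×1≈0 : q ×ᴿ 1# ≈ 0#
  order×1≈0 = ⊕-cancelˡ (S.sum enum) (q ×ᴿ 1#) 0# (begin
    S.sum enum ⊕ q ×ᴿ 1#                       ≈⟨ ⊕-congˡ (S.sum-replicate q) ⟨
    S.sum enum ⊕ S.sum (λ (i : Fin q) → 1#)    ≈⟨ S.∑-distrib-+ enum (λ _ → 1#) ⟨
    S.sum (λ i → enum i ⊕ 1#)                  ≈⟨ S.sum-cong-≋ (λ i → enum-index (enum i ⊕ 1#)) ⟨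
    S.sum (λ i → enum (index (enum i ⊕ 1#)))   ≈⟨ S.sum-permute enum π ⟨
    S.sum enum                                 ≈⟨ ⊕-identityʳ _ ⟨
    S.sum enum ⊕ 0#                            ∎)
    where
    open ≈-Reasoning
    π = permutation (λ i → index (enum i ⊕ 1#)) (λ i → index (enum i ⊕ ⊖ 1#))
          (λ i → enum-inj _ _ (≈-trans (enum-index _) (≈-trans (⊕-congʳ (enum-index _)) (⊖⊕-cancel (enum i) 1#))))
          (λ i → enum-inj _ _ (≈-trans (enum-index _) (≈-trans (⊕-congʳ (enum-index _)) (⊕⊖-cancel (enum i) 1#))))

  ^×1 : ∀ p k → (p ^ k) ×ᴿ 1# ≈ (p ×ᴿ 1#) ↑ k
  ^×1 p zero    = ⊕-identityʳ 1#
  ^×1 p (suc k) = ≈-trans (×1-homo-* p (p ^ k)) (⊗-congˡ (^×1 p k))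

  -- The k-th power of `p ×ᴿ 1#` is `q ×ᴿ 1#`, hence zero, and a field has no nonzero nilpotent
  -- element.
  prime×1≈0 : ∀ p k → q ≡ p ^ k → p ×ᴿ 1# ≈ 0#
  prime×1≈0 p k refl with (p ×ᴿ 1#) ≟ 0#
  ... | yes e = e
  ... | no ¬e = contradiction (≈-trans (≈-sym (^×1 p k)) order×1≈0) (↑-≉0 k ¬e)

  -- The Frobenius map

  module Frobenius (p : ℕ) (pr : Prime p) (char : p ×ᴿ 1# ≈ 0#) where

    ∣⇒×≈0 : ∀ {n} x → p ∣ n → n ×ᴿ x ≈ 0#
    ∣⇒×≈0 x (divides d refl) = begin
      (d * p) ×ᴿ x              ≈⟨ ×-congʳ (d * p) (⊗-identityˡ x) ⟨
      (d * p) ×ᴿ (1# ⊗ x)       ≈⟨ ×-assoc-* (d * p) 1# x ⟨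
      ((d * p) ×ᴿ 1#) ⊗ x       ≈⟨ ⊗-congʳ (×1-homo-* d p) ⟩
      (d ×ᴿ 1#) ⊗ (p ×ᴿ 1#) ⊗ x ≈⟨ ⊗-congʳ (⊗-congˡ char) ⟩
      (d ×ᴿ 1#) ⊗ 0# ⊗ x        ≈⟨ ⊗-congʳ (⊗-zeroʳ _) ⟩
      0# ⊗ x                    ≈⟨ ⊗-zeroˡ x ⟩
      0#                        ∎
      where open ≈-Reasoning

    private
      binomial : ∀ n → n ≡ p → ∀ x y → (x ⊕ y) ↑ n ≈ x ↑ n ⊕ y ↑ n
      binomial zero    refl = contradiction refl (Data.Nat.≢-nonZero⁻¹ p {{prime⇒nonZero pr}})
      binomial (suc n) refl x y = begin
        (x ⊕ y) ↑ suc n                      ≡⟨ ↑≡^ (x ⊕ y) (suc n) ⟩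
        (x ⊕ y) E.^ suc n                    ≈⟨ Bin.theorem (suc n) x y ⟩
        t Fin.zero ⊕ S.sum (t ∘ Fin.suc)     ≈⟨ ⊕-congˡ (S.sum-init-last (t ∘ Fin.suc)) ⟩
        t Fin.zero ⊕ (S.sum (t ∘ Fin.suc ∘ inject₁) ⊕ t (Fin.suc (fromℕ n)))
          ≈⟨ ⊕-cong t-first (⊕-cong (≈-trans (S.sum-cong-≋ t-middle) (S.sum-replicate-zero n)) t-last) ⟩
        y ↑ suc n ⊕ (0# ⊕ x ↑ suc n)         ≈⟨ ⊕-congˡ (⊕-identityˡ _) ⟩
        y ↑ suc n ⊕ x ↑ suc n                ≈⟨ ⊕-comm _ _ ⟩
        x ↑ suc n ⊕ y ↑ suc n                ∎
        where
        open ≈-Reasoning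
        module Bin = Binomial commutativeSemiring
        t = Bin.binomialTerm x y (suc n)
        t-first : t Fin.zero ≈ y ↑ suc n
        t-first = begin
          1 ×ᴿ (1# ⊗ y E.^ suc n) ≈⟨ ⊕-identityʳ _ ⟩
          1# ⊗ y E.^ suc n        ≈⟨ ⊗-identityˡ _ ⟩
          y E.^ suc n             ≡⟨ ↑≡^ y (suc n) ⟨
          y ↑ suc n               ∎
        t-last : t (Fin.suc (fromℕ n)) ≈ x ↑ suc n
        t-last rewrite toℕ-fromℕ n | nCn≡1 (suc n) | n∸n≡0 n | ↑≡^ x n =
          ≈-trans (⊕-identityʳ _) (⊗-identityʳ _)
        t-middle : ∀ i → t (Fin.suc (inject₁ i)) ≈ 0#
        t-middle i = ∣⇒×≈0 _ (prime∣pC[k+1] pr (s<s (subst (_< n) (sym (toℕ-inject₁ i)) (toℕ<n i))))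

    ↑p-⊕ : ∀ x y → (x ⊕ y) ↑ p ≈ x ↑ p ⊕ y ↑ p
    ↑p-⊕ = binomial p refl

    ↑p^i-⊕ : ∀ i x y → (x ⊕ y) ↑ (p ^ i) ≈ x ↑ (p ^ i) ⊕ y ↑ (p ^ i)
    ↑p^i-⊕ zero    x y = ≈-trans (↑-1 _) (≈-sym (⊕-cong (↑-1 x) (↑-1 y)))
    ↑p^i-⊕ (suc i) x y = begin
      (x ⊕ y) ↑ (p * p ^ i)                     ≈⟨ ↑-* (x ⊕ y) p (p ^ i) ⟨
      ((x ⊕ y) ↑ p) ↑ (p ^ i)                   ≈⟨ ↑-congˡ (p ^ i) (↑p-⊕ x y) ⟩
      (x ↑ p ⊕ y ↑ p) ↑ (p ^ i)                 ≈⟨ ↑p^i-⊕ i (x ↑ p) (y ↑ p) ⟩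
      (x ↑ p) ↑ (p ^ i) ⊕ (y ↑ p) ↑ (p ^ i)     ≈⟨ ⊕-cong (↑-* x p (p ^ i)) (↑-* y p (p ^ i)) ⟩
      x ↑ (p * p ^ i) ⊕ y ↑ (p * p ^ i)         ∎
      where open ≈-Reasoning

  -- Elements of finite order and the subgroups of the multiplicative group

  0↑ : ∀ n → 0 < n → 0# ↑ n ≈ 0#
  0↑ (suc n) _ = ⊗-zeroˡ _

  -- For n = q ∸ 1 this unfolds to the same type as `IsPrimitive R q g`, so the hypothesis on `α`
  -- serves directly as an order statement.
  HasOrder : Carrier → ℕ → Set
  HasOrder g n = (g ↑ n ≈ 1#) × (∀ k → 0 < k → k < n → ¬ (g ↑ k ≈ 1#))

  ↑-multiple : ∀ {g n} → g ↑ n ≈ 1# → ∀ k → g ↑ (k * n) ≈ 1#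
  ↑-multiple {g} {n} gⁿ≈1 k =
    ≈-trans (↑-congʳ g (*-comm k n)) (≈-trans (≈-sym (↑-* g n k)) (≈-trans (↑-congˡ k gⁿ≈1) (1↑ k)))

  -- Reducing k modulo n does not change the power, and a nonzero remainder would contradict
  -- minimality.
  order-∣ : ∀ {g n} → 0 < n → HasOrder g n → ∀ k → g ↑ k ≈ 1# → n ∣ k
  order-∣ {g} {n} n>0 (gⁿ≈1 , minimal) k gᵏ≈1 with k % n in eq
    where instance _ = >-nonZero n>0
  ... | zero  = divides (k / n) (trans (m≡m%n+[m/n]*n k n) (cong (_+ k / n * n) eq))
    where instance _ = >-nonZero n>0
  ... | suc r = contradiction gʳ≈1 (minimal (suc r) z<s (subst (_< n) eq (m%n<n k n)))
    where
    instance _ = >-nonZero n>0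
    open ≈-Reasoning
    gʳ≈1 : g ↑ suc r ≈ 1#
    gʳ≈1 = begin
      g ↑ suc r                         ≈⟨ ⊗-identityʳ _ ⟨
      g ↑ suc r ⊗ 1#                    ≈⟨ ⊗-congˡ (↑-multiple gⁿ≈1 (k / n)) ⟨
      g ↑ suc r ⊗ g ↑ (k / n * n)       ≈⟨ ↑-+ g (suc r) _ ⟨
      g ↑ (suc r + k / n * n)           ≡⟨ cong (λ z → g ↑ (z + k / n * n)) eq ⟨
      g ↑ (k % n + k / n * n)           ≡⟨ cong (g ↑_) (m≡m%n+[m/n]*n k n) ⟨
      g ↑ k                             ≈⟨ gᵏ≈1 ⟩
      1#                                ∎

  HasOrder-↑ : ∀ {g r s} → 0 < r → HasOrder g (r * s) → HasOrder (g ↑ r) s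
  HasOrder-↑ {g} {r} {s} r>0 (gⁿ≈1 , minimal) =
    ≈-trans (↑-* g r s) gⁿ≈1 ,
    λ k k>0 k<s e → minimal (r * k) (subst (_< r * k) (*-zeroʳ r) (*-monoʳ-< r k>0)) (*-monoʳ-< r k<s)
      (≈-trans (≈-sym (↑-* g r k)) e)
    where instance _ = >-nonZero r>0

  HasOrder-≉0 : ∀ {g n} → 0 < n → HasOrder g n → ¬ (g ≈ 0#)
  HasOrder-≉0 {g} {n} n>0 (gⁿ≈1 , _) g≈0 =
    1≉0 (≈-trans (≈-sym gⁿ≈1) (≈-trans (↑-congˡ n g≈0) (0↑ n n>0)))

  ↑-injective : ∀ {g n} → 0 < n → HasOrder g n → ∀ {i j} → i < j → j < n → ¬ (g ↑ i ≈ g ↑ j)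
  ↑-injective {g} {n} n>0 ord@(_ , minimal) {i} {j} i<j j<n e =
    minimal (j ∸ i) (m<n⇒0<n∸m i<j) (≤-<-trans (m∸n≤m j i) j<n)
      (⊗-cancelˡ (↑-≉0 i (HasOrder-≉0 n>0 ord)) (begin
        g ↑ i ⊗ g ↑ (j ∸ i)   ≈⟨ ↑-+ g i (j ∸ i) ⟨
        g ↑ (i + (j ∸ i))     ≡⟨ cong (g ↑_) (m+[n∸m]≡n (<⇒≤ i<j)) ⟩
        g ↑ j                 ≈⟨ e ⟨
        g ↑ i                 ≈⟨ ⊗-identityʳ _ ⟨
        g ↑ i ⊗ 1#            ∎))
    where open ≈-Reasoning

  index-injective : ∀ {x y} → index x ≡ index y → x ≈ y
  index-injective {x} {y} e = ≈-trans (≈-sym (enum-index x)) (≈-trans (≈-reflexive (cong enum e)) (enum-index y))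

  module Generator (n : ℕ) (q≡1+n : q ≡ suc n) (n>0 : 0 < n) (α : Carrier) (α-order : HasOrder α n) where

    α≉0 : ¬ (α ≈ 0#)
    α≉0 = HasOrder-≉0 n>0 α-order

    private
      power? : ∀ x → Dec (∃ λ (k : Fin n) → α ↑ toℕ k ≈ x)
      power? x = any? (λ k → (α ↑ toℕ k) ≟ x)

    -- If x were missed, then x, 0 and the n powers of `α` would be n + 2 distinct elements of a
    -- field with n + 1.
    log : ∀ x → ¬ (x ≈ 0#) → ∃ λ (k : Fin n) → α ↑ toℕ k ≈ x
    log x x≉0 with power? x
    ... | yes found = found
    ... | no missed = contradiction (pigeonhole (subst (_< suc (suc n)) (sym q≡1+n) (n<1+n _)) (index ∘ element)) distinct
      where
      element : Fin (suc (suc n)) → Carrier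
      element Fin.zero              = x
      element (Fin.suc Fin.zero)    = 0#
      element (Fin.suc (Fin.suc k)) = α ↑ toℕ k

      distinct : ¬ (∃ λ i → ∃ λ j → (toℕ i < toℕ j) × index (element i) ≡ index (element j))
      distinct (Fin.zero            , Fin.suc Fin.zero    , _ , e) = x≉0 (index-injective e)
      distinct (Fin.zero            , Fin.suc (Fin.suc k) , _ , e) = missed (k , ≈-sym (index-injective e))
      distinct (Fin.suc Fin.zero    , Fin.suc (Fin.suc k) , _ , e) = ↑-≉0 (toℕ k) α≉0 (≈-sym (index-injective e))
      distinct (Fin.suc Fin.zero    , Fin.suc Fin.zero    , s<s () , _)
      distinct (Fin.suc (Fin.suc i) , Fin.suc Fin.zero    , s<s () , _)
      distinct (Fin.suc (Fin.suc i) , Fin.suc (Fin.suc j) , s<s (s<s i<j) , e) =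
        ↑-injective n>0 α-order i<j (toℕ<n j) (index-injective e)

    ↑-order : ∀ x → x ↑ q ≈ x
    ↑-order x with x ≟ 0#
    ... | yes x≈0 = ≈-trans (↑-congˡ q x≈0) (≈-trans (0↑ q (subst (0 <_) (sym q≡1+n) z<s)) (≈-sym x≈0))
    ... | no  x≉0 with k , αᵏ≈x ← log x x≉0 = begin
      x ↑ q                   ≡⟨ cong (x ↑_) q≡1+n ⟩
      x ⊗ x ↑ n               ≈⟨ ⊗-congˡ (↑-congˡ n αᵏ≈x) ⟨
      x ⊗ (α ↑ toℕ k) ↑ n     ≈⟨ ⊗-congˡ (↑-* α (toℕ k) n) ⟩
      x ⊗ α ↑ (toℕ k * n)     ≈⟨ ⊗-congˡ (↑-multiple (proj₁ α-order) (toℕ k)) ⟩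
      x ⊗ 1#                  ≈⟨ ⊗-identityʳ x ⟩
      x                       ∎
      where open ≈-Reasoning

    -- A partition of unity: existence and uniqueness of the logarithm in the form of a count.
    -- Multiplied by `f x` and summed over x, it gives `∑-powers`.
    zero-or-power : ∀ x → δ x 0# + ∑< n (λ k → δ x (α ↑ k)) ≡ 1
    zero-or-power x with x ≟ 0#
    ... | yes x≈0 = cong suc (sum-zero _ (λ (k : Fin n) → δ-no (λ e → ↑-≉0 (toℕ k) α≉0 (≈-trans (≈-sym e) x≈0))))
    ... | no  x≉0 with k₀ , e₀ ← log x x≉0 =
      trans (sum-single _ k₀ (λ k k≢k₀ → δ-no (λ e → k≢k₀ (log-unique (≈-trans e₀ e))))) (δ-yes (≈-sym e₀))
      where
      log-unique : ∀ {i j : Fin n} → α ↑ toℕ i ≈ α ↑ toℕ j → j ≡ i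
      log-unique {i} {j} e with <-cmp (toℕ i) (toℕ j)
      ... | tri< i<j _ _ = contradiction e (↑-injective n>0 α-order i<j (toℕ<n j))
      ... | tri≈ _ i≡j _ = toℕ-injective (sym i≡j)
      ... | tri> _ _ j<i = contradiction (≈-sym e) (↑-injective n>0 α-order j<i (toℕ<n i))

    ∑-powers : ∀ {f} → Congruent f → ∑ f ≡ f 0# + ∑< n (λ k → f (α ↑ k))
    ∑-powers {f} f-cong = begin
      ∑ f
        ≡⟨ ∑-cong split ⟩
      ∑ (λ x → δ x 0# * f x + ∑< n (λ k → δ x (α ↑ k) * f x))
        ≡⟨ ∑-+ (λ x → δ x 0# * f x) (λ x → ∑< n (λ k → δ x (α ↑ k) * f x)) ⟩
      ∑ (λ x → δ x 0# * f x) + ∑ (λ x → ∑< n (λ k → δ x (α ↑ k) * f x))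
        ≡⟨ cong₂ _+_ (∑-δ 0# f-cong) (∑-comm (λ i (k : Fin n) → δ (enum i) (α ↑ toℕ k) * f (enum i))) ⟩
      f 0# + ∑< n (λ k → ∑ (λ x → δ x (α ↑ k) * f x))
        ≡⟨ cong (f 0# +_) (∑<-cong n (λ k → ∑-δ (α ↑ k) f-cong)) ⟩
      f 0# + ∑< n (λ k → f (α ↑ k))
        ∎
      where
      open ≡-Reasoning
      split : ∀ x → f x ≡ δ x 0# * f x + ∑< n (λ k → δ x (α ↑ k) * f x)
      split x = begin
        f x                                                     ≡⟨ *-identityˡ (f x) ⟨
        1 * f x                                                 ≡⟨ cong (_* f x) (zero-or-power x) ⟨
        (δ x 0# + ∑< n (λ k → δ x (α ↑ k))) * f x               ≡⟨ *-distribʳ-+ (f x) (δ x 0#) _ ⟩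
        δ x 0# * f x + ∑< n (λ k → δ x (α ↑ k)) * f x
          ≡⟨ cong (δ x 0# * f x +_) (*-distribʳ-sum (f x) (λ (k : Fin n) → δ x (α ↑ toℕ k))) ⟩
        δ x 0# * f x + ∑< n (λ k → δ x (α ↑ k) * f x)           ∎

    -- The subgroup of order s is generated by `α ↑ r`, and together with 0 it is the solution set
    -- of x^(s+1) = x. When s + 1 is p or p^m this solution set is a subfield.
    module Subgroup (r s : ℕ) (rs≡n : r * s ≡ n) where

      private
        r>0 : 0 < r
        r>0 = n≢0⇒n>0 (λ { refl → n≮n 0 (subst (0 <_) (sym rs≡n) n>0) })
        s>0 : 0 < s
        s>0 = n≢0⇒n>0 (λ { refl → n≮n 0 (subst (0 <_) (trans (sym rs≡n) (*-zeroʳ r)) n>0) })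
        instance
          r≢0 : NonZero r
          r≢0 = >-nonZero r>0
          s≢0 : NonZero s
          s≢0 = >-nonZero s>0

      fixed⇒∣ : ∀ k → (α ↑ k) ↑ suc s ≈ α ↑ k → r ∣ k
      fixed⇒∣ k e = *-cancelʳ-∣ s (subst (_∣ k * s) (sym rs≡n) (order-∣ n>0 α-order (k * s)
        (≈-trans (≈-sym (↑-* α k s)) (⊗-cancelˡ (↑-≉0 k α≉0) (≈-trans e (≈-sym (⊗-identityʳ _)))))))

      ↑*-fixed : ∀ j → (α ↑ (j * r)) ↑ suc s ≈ α ↑ (j * r)
      ↑*-fixed j = ≈-trans (⊗-congˡ (begin
        (α ↑ (j * r)) ↑ s   ≈⟨ ↑-* α (j * r) s ⟩
        α ↑ (j * r * s)     ≡⟨ cong (α ↑_) (trans (*-assoc j r s) (cong (j *_) rs≡n)) ⟩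
        α ↑ (j * n)         ≈⟨ ↑-multiple (proj₁ α-order) j ⟩
        1#                  ∎)) (⊗-identityʳ _)
        where open ≈-Reasoning

      fixed-is-power : ∀ x → ¬ (x ≈ 0#) → x ↑ suc s ≈ x → ∃ λ j → α ↑ (j * r) ≈ x
      fixed-is-power x x≉0 e with log x x≉0
      ... | k , αᵏ≈x with fixed⇒∣ (toℕ k) (≈-trans (↑-congˡ (suc s) αᵏ≈x) (≈-trans e (≈-sym αᵏ≈x)))
      ... | divides j k≡jr = j , ≈-trans (↑-congʳ α (sym k≡jr)) αᵏ≈x

      -- With exponents written as j r + i for i < r, a power of `α` is fixed only if r divides its
      -- exponent, so each block contributes its term i = 0 alone.
      ∑-fixed : ∀ {f} → Congruent f →
                ∑ (λ x → δ (x ↑ suc s) x * f x) ≡ f 0# + ∑< s (λ j → f (α ↑ (j * r)))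
      ∑-fixed {f} f-cong = begin
        ∑ g                                     ≡⟨ ∑-powers g-cong ⟩
        g 0# + ∑< n (λ k → g (α ↑ k))
          ≡⟨ cong₂ _+_ g0≡f0 (cong (λ N → ∑< N (λ k → g (α ↑ k))) (trans (sym rs≡n) (*-comm r s))) ⟩
        f 0# + ∑< (s * r) (λ k → g (α ↑ k))     ≡⟨ cong (f 0# +_) (∑<-* s r (λ k → g (α ↑ k))) ⟩
        f 0# + ∑< s (λ j → ∑< r (λ i → g (α ↑ (j * r + i))))
          ≡⟨ cong (f 0# +_) (∑<-cong s block) ⟩
        f 0# + ∑< s (λ j → f (α ↑ (j * r)))     ∎
        where
        open ≡-Reasoning
        g : Carrier → ℕ
        g x = δ (x ↑ suc s) x * f x

        g-cong : Congruent g
        g-cong e = cong₂ _*_ (δ-cong (↑-congˡ (suc s) e) e) (f-cong e)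

        g0≡f0 : g 0# ≡ f 0#
        g0≡f0 = trans (cong (_* f 0#) (δ-yes (0↑ (suc s) z<s))) (*-identityˡ _)

        off : ∀ j i → i < r → i ≢ 0 → g (α ↑ (j * r + i)) ≡ 0
        off j i i<r i≢0 = cong (_* f (α ↑ (j * r + i))) (δ-no (λ e →
          <⇒≱ i<r (∣⇒≤ {{≢-nonZero i≢0}} (∣m+n∣m⇒∣n (fixed⇒∣ (j * r + i) e) (n∣m*n j)))))

        block : ∀ j → ∑< r (λ i → g (α ↑ (j * r + i))) ≡ f (α ↑ (j * r))
        block j = begin
          ∑< r (λ i → g (α ↑ (j * r + i)))
            ≡⟨ sum-single _ (fromℕ< r>0) (λ i i≢0 → off j (toℕ i) (toℕ<n i)
                 (λ e → i≢0 (toℕ-injective (trans e (sym (toℕ-fromℕ< r>0)))))) ⟩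
          g (α ↑ (j * r + toℕ (fromℕ< r>0)))
            ≡⟨ cong (λ i → g (α ↑ i)) (trans (cong (j * r +_) (toℕ-fromℕ< r>0)) (+-identityʳ _)) ⟩
          g (α ↑ (j * r))
            ≡⟨ trans (cong (_* f (α ↑ (j * r))) (δ-yes (↑*-fixed j))) (*-identityˡ _) ⟩
          f (α ↑ (j * r)) ∎

      -- The r-th power map is r-to-one from the nonzero elements onto the subgroup of order s: with
      -- exponents written as j s + i, the part j s r is a multiple of n and the image depends on i
      -- only.
      ∑-power-map : ∀ {f} → Congruent f →
                    ∑ (λ x → f (x ↑ r)) ≡ f 0# + r * ∑< s (λ j → f (α ↑ (j * r)))
      ∑-power-map {f} f-cong = begin
        ∑ (λ x → f (x ↑ r))
          ≡⟨ ∑-powers (λ e → f-cong (↑-congˡ r e)) ⟩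
        f (0# ↑ r) + ∑< n (λ k → f ((α ↑ k) ↑ r))
          ≡⟨ cong₂ _+_ (f-cong (0↑ r r>0)) (cong (λ N → ∑< N (λ k → f ((α ↑ k) ↑ r))) (sym rs≡n)) ⟩
        f 0# + ∑< (r * s) (λ k → f ((α ↑ k) ↑ r))
          ≡⟨ cong (f 0# +_) (∑<-* r s (λ k → f ((α ↑ k) ↑ r))) ⟩
        f 0# + ∑< r (λ j → ∑< s (λ i → f ((α ↑ (j * s + i)) ↑ r)))
          ≡⟨ cong (f 0# +_) (∑<-cong r (λ j → ∑<-cong s (λ i → f-cong (periodic j i)))) ⟩
        f 0# + ∑< r (λ _ → ∑< s (λ i → f (α ↑ (i * r))))
          ≡⟨ cong (f 0# +_) (sum-const r _) ⟩
        f 0# + r * ∑< s (λ j → f (α ↑ (j * r))) ∎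
        where
        open ≡-Reasoning
        periodic : ∀ j i → (α ↑ (j * s + i)) ↑ r ≈ α ↑ (i * r)
        periodic j i = R.begin
          (α ↑ (j * s + i)) ↑ r         R.≈⟨ ↑-* α (j * s + i) r ⟩
          α ↑ ((j * s + i) * r)
            R.≡⟨ cong (α ↑_) (trans (*-distribʳ-+ r (j * s) i)
                   (cong (_+ i * r) (trans (*-assoc j s r) (cong (j *_) (trans (*-comm s r) rs≡n))))) ⟩
          α ↑ (j * n + i * r)           R.≈⟨ ↑-+ α (j * n) (i * r) ⟩
          α ↑ (j * n) ⊗ α ↑ (i * r)     R.≈⟨ ⊗-congʳ (↑-multiple (proj₁ α-order) j) ⟩
          1# ⊗ α ↑ (i * r)              R.≈⟨ ⊗-identityˡ _ ⟩
          α ↑ (i * r)                   R.∎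
          where module R = ≈-Reasoning

-- Bounded search

anyBelow⁺ : ∀ k (f : ℕ → Bool) {j} → j < k → f j ≡ true → anyBelow k f ≡ true
anyBelow⁺ (suc k) f {j} j<1+k fj with f k in eq
... | true  = refl
... | false = anyBelow⁺ k f (≤∧≢⇒< (≤-pred j<1+k) λ { refl → contradiction (trans (sym fj) eq) λ () }) fj

anyBelow⁻ : ∀ k (f : ℕ → Bool) → anyBelow k f ≡ true → ∃ λ j → j < k × f j ≡ true
anyBelow⁻ (suc k) f any with f k in eq
... | true  = k , ≤-refl , eq
... | false with j , j<k , fj ← anyBelow⁻ k f any = j , m<n⇒m<1+n j<k , fj

∧-true : ∀ {a b} → a ∧ b ≡ true → a ≡ true × b ≡ true
∧-true {true} b≡true = refl , b≡true

does-true : ∀ {A : Set} (a? : Dec A) → does a? ≡ true → A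
does-true (yes a) _ = a

-- The fields of the theorem

module Theorem (p m : ℕ) (p-prime : Prime p) (p-odd : p % 2 ≡ 1) (1<m : 1 < m)
               (R : CommutativeRing 0ℓ 0ℓ) (F : IsFiniteFieldOfOrder R (p ^ (2 * m)))
               (α : CommutativeRing.Carrier R) (α-prim : IsPrimitive R (p ^ (2 * m)) α)
               (e : ℕ) (e[p-1]≡p^m-1 : e * (p ∸ 1) ≡ p ^ m ∸ 1) where

  open FiniteField F
  open SemiringSolver commutativeSemiring using (solve; _:=_; _:+_; _:*_)

  instance
    p≢0 : NonZero p
    p≢0 = prime⇒nonZero p-prime

  1<p : 1 < p
  1<p = nonTrivial⇒n>1 p {{prime⇒nonTrivial p-prime}}

  n s M u : ℕ
  n = p ^ (2 * m) ∸ 1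
  s = p ∸ 1
  M = p ^ m ∸ 1
  u = p ^ m + 1

  p≡1+s : p ≡ suc s
  p≡1+s = sym (m+[n∸m]≡n (<⇒≤ 1<p))

  p^k≡1+ : ∀ k → p ^ k ≡ suc (p ^ k ∸ 1)
  p^k≡1+ k = sym (m+[n∸m]≡n (m^n>0 p k))

  uM≡n : u * M ≡ n
  uM≡n = begin
    (p ^ m + 1) * M            ≡⟨ cong (λ z → (z + 1) * M) (p^k≡1+ m) ⟩
    (suc M + 1) * M            ≡⟨ expand M ⟩
    suc M * suc M ∸ 1          ≡⟨ cong (λ z → z * z ∸ 1) (p^k≡1+ m) ⟨
    p ^ m * p ^ m ∸ 1          ≡⟨ cong (_∸ 1) (^-distribˡ-+-* p m m) ⟨
    p ^ (m + m) ∸ 1            ≡⟨ cong (λ z → p ^ (m + z) ∸ 1) (+-identityʳ m) ⟨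
    n                          ∎
    where
    open ≡-Reasoning
    expand : ∀ x → (suc x + 1) * x ≡ x + x * suc x
    expand = solve-∀

  eus≡n : (e * u) * s ≡ n
  eus≡n = begin
    (e * u) * s      ≡⟨ rearrange e u s ⟩
    u * (e * s)      ≡⟨ cong (u *_) e[p-1]≡p^m-1 ⟩
    u * M            ≡⟨ uM≡n ⟩
    n                ∎
    where
    open ≡-Reasoning
    rearrange : ∀ a b c → (a * b) * c ≡ b * (a * c)
    rearrange = solve-∀

  0<m : 0 < m
  0<m = <⇒≤ 1<m

  p^k>1 : ∀ {k} → 0 < k → 1 < p ^ k
  p^k>1 = ^-monoʳ-< p 1<p

  M>0 : 0 < M
  M>0 = m<n⇒0<n∸m (p^k>1 0<m)

  n>0 : 0 < n
  n>0 = subst (0 <_) uM≡n (*-mono-≤ {1} {u} {1} {M} (m≤n+m 1 (p ^ m)) M>0)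

  char : p ×ᴿ 1# ≈ 0#
  char = prime×1≈0 p (2 * m) refl

  open Frobenius p p-prime char
  open Generator n (p^k≡1+ (2 * m)) n>0 α α-prim
  -- Since `p` is `suc s` and `p ^ m` is `suc M`, the two instances enumerate GF(p) and GF(p^m). The
  -- indices of their multiplicative groups are `e * u` and `u`.
  module 𝔽 = Subgroup (e * u) s eus≡n
  module 𝕃 = Subgroup u M uM≡n

  -- GF(p) as the fixed points of Frobenius, so that closure under the field operations follows from
  -- additivity and multiplicativity of the p-th power.
  ∈F : Carrier → Set
  ∈F c = c ↑ p ≈ c

  ∈F-resp : ∀ {c d} → c ≈ d → ∈F c → ∈F d
  ∈F-resp c≈d c∈F = ≈-trans (↑-congˡ p (≈-sym c≈d)) (≈-trans c∈F c≈d)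

  0∈F : ∈F 0#
  0∈F = 0↑ p (<⇒≤ 1<p)

  1∈F : ∈F 1#
  1∈F = 1↑ p

  ⊕∈F : ∀ {c d} → ∈F c → ∈F d → ∈F (c ⊕ d)
  ⊕∈F c∈F d∈F = ≈-trans (↑p-⊕ _ _) (⊕-cong c∈F d∈F)

  ⊗∈F : ∀ {c d} → ∈F c → ∈F d → ∈F (c ⊗ d)
  ⊗∈F c∈F d∈F = ≈-trans (↑-⊗ _ _ p) (⊗-cong c∈F d∈F)

  ⊖∈F : ∀ {c} → ∈F c → ∈F (⊖ c)
  ⊖∈F {c} c∈F = ⊕-cancelˡ c _ _ (begin
    c ⊕ (⊖ c) ↑ p       ≈⟨ ⊕-congʳ c∈F ⟨
    c ↑ p ⊕ (⊖ c) ↑ p   ≈⟨ ↑p-⊕ c (⊖ c) ⟨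
    (c ⊕ ⊖ c) ↑ p       ≈⟨ ↑-congˡ p (⊖-inverseʳ c) ⟩
    0# ↑ p              ≈⟨ 0∈F ⟩
    0#                  ≈⟨ ⊖-inverseʳ c ⟨
    c ⊕ ⊖ c             ∎)
    where open ≈-Reasoning

  inverse∈F : ∀ {c d} → ∈F c → c ⊗ d ≈ 1# → ¬ (c ≈ 0#) → ∈F d
  inverse∈F {c} {d} c∈F cd≈1 c≉0 = ⊗-cancelˡ c≉0 (begin
    c ⊗ d ↑ p       ≈⟨ ⊗-congʳ c∈F ⟨
    c ↑ p ⊗ d ↑ p   ≈⟨ ↑-⊗ c d p ⟨
    (c ⊗ d) ↑ p     ≈⟨ ↑-congˡ p cd≈1 ⟩
    1# ↑ p          ≈⟨ 1↑ p ⟩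
    1#              ≈⟨ cd≈1 ⟨
    c ⊗ d           ∎)
    where open ≈-Reasoning

  -- The indicator of GF(p), by which a sum over GF(p) becomes a weighted sum over the whole field.
  φ : Carrier → ℕ
  φ c = δ (c ↑ p) c

  φ-cong : Congruent φ
  φ-cong e = δ-cong (↑-congˡ p e) e

  ∑-F : ∀ {f c₁} → Congruent f → (∀ c → ∈F c → ¬ (c ≈ 0#) → f c ≡ c₁) →
        ∑ (λ c → φ c * f c) ≡ f 0# + s * c₁
  ∑-F {f} {c₁} f-cong const = begin
    ∑ (λ c → φ c * f c)
      ≡⟨ ∑-cong (λ c → cong (λ k → δ (c ↑ k) c * f c) p≡1+s) ⟩
    ∑ (λ c → δ (c ↑ suc s) c * f c)
      ≡⟨ 𝔽.∑-fixed f-cong ⟩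
    f 0# + ∑< s (λ j → f (α ↑ (j * (e * u))))
      ≡⟨ cong (f 0# +_) (∑<-cong s (λ j → const _
           (≈-trans (↑-congʳ (α ↑ (j * (e * u))) p≡1+s) (𝔽.↑*-fixed j)) (↑-≉0 (j * (e * u)) α≉0))) ⟩
    f 0# + ∑< s (λ _ → c₁)
      ≡⟨ cong (f 0# +_) (sum-const s c₁) ⟩
    f 0# + s * c₁
      ∎
    where open ≡-Reasoning

  -- Equidistribution by translation

  module Weighted (w : Carrier → ℕ) (w-cong : Congruent w)
                  (T : Carrier → Carrier) (T-cong : ∀ {x y} → x ≈ y → T x ≈ T y)
                  (T∈F : ∀ x → w x ≢ 0 → ∈F (T x)) where

    fibre : Carrier → ℕ
    fibre c = ∑ (λ x → w x * δ (T x) c)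

    fibre-cong : Congruent fibre
    fibre-cong c≈d = ∑-cong (λ x → cong (w x *_) (δ-congˡ {T x} c≈d))

    ∑-fibre : ∑ (λ c → φ c * fibre c) ≡ ∑ w
    ∑-fibre = begin
      ∑ (λ c → φ c * fibre c)
        ≡⟨ ∑-cong (λ c → ∑-*ˡ (φ c) (λ x → w x * δ (T x) c)) ⟨
      ∑ (λ c → ∑ (λ x → φ c * (w x * δ (T x) c)))
        ≡⟨ ∑-swap (λ c x → φ c * (w x * δ (T x) c)) ⟩
      ∑ (λ x → ∑ (λ c → φ c * (w x * δ (T x) c)))
        ≡⟨ ∑-cong (λ x → ∑-cong (λ c → trans (rearrange (φ c) (w x) (δ (T x) c))
               (cong (λ z → w x * (z * φ c)) (δ-sym {T x} {c})))) ⟩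
      ∑ (λ x → ∑ (λ c → w x * (δ c (T x) * φ c)))
        ≡⟨ ∑-cong (λ x → trans (∑-*ˡ (w x) (λ c → δ c (T x) * φ c)) (cong (w x *_) (∑-δ (T x) φ-cong))) ⟩
      ∑ (λ x → w x * φ (T x))
        ≡⟨ ∑-cong absorb ⟩
      ∑ w ∎
      where
      open ≡-Reasoning
      rearrange : ∀ a b c → a * (b * c) ≡ b * (c * a)
      rearrange = solve-∀
      -- `T x` lies in GF(p) wherever the weight is nonzero, so restricting c to GF(p) loses
      -- nothing.
      absorb : ∀ x → w x * φ (T x) ≡ w x
      absorb x with w x Data.Nat.≟ 0
      ... | yes w≡0 = trans (cong (_* φ (T x)) w≡0) (sym w≡0)
      ... | no  w≢0 = trans (cong (w x *_) (δ-yes (T∈F x w≢0))) (*-identityʳ (w x))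

    -- Translation by (a - b) t carries the fibre over b to the fibre over a and preserves weights.
    -- The p fibres are therefore equal, and each is a p-th part of the total weight. The shift of
    -- `T` is asked for only on the support of w, since for some uses it fails elsewhere.
    module Shift (t : Carrier) (w-shift : ∀ c → ∈F c → ∀ x → w (x ⊕ c ⊗ t) ≡ w x)
                 (T-shift : ∀ c → ∈F c → ∀ x → w x ≢ 0 → T (x ⊕ c ⊗ t) ≈ T x ⊕ c) where

      fibre-const : ∀ {a b} → ∈F a → ∈F b → fibre a ≡ fibre b
      fibre-const {a} {b} a∈F b∈F = begin
        ∑ (λ x → w x * δ (T x) a)
          ≡⟨ ∑-bij (_⊕ h) (_⊕ ⊖ h) ⊕-congʳ ⊕-congʳ (λ x → ⊖⊕-cancel x h) (λ x → ⊕⊖-cancel x h)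
               (λ e → cong₂ _*_ (w-cong e) (δ-congʳ (T-cong e))) ⟨
        ∑ (λ x → w (x ⊕ h) * δ (T (x ⊕ h)) a)
          ≡⟨ ∑-cong pointwise ⟩
        ∑ (λ x → w x * δ (T x) b) ∎
        where
        open ≡-Reasoning
        a-b = a ⊕ ⊖ b
        h = a-b ⊗ t
        a-b∈F : ∈F a-b
        a-b∈F = ⊕∈F a∈F (⊖∈F b∈F)
        b+[a-b]≈a : b ⊕ a-b ≈ a
        b+[a-b]≈a = ≈-trans (⊕-comm b a-b) (⊖⊕-cancel a b)
        pointwise : ∀ x → w (x ⊕ h) * δ (T (x ⊕ h)) a ≡ w x * δ (T x) b
        pointwise x with w x Data.Nat.≟ 0
        ... | yes w≡0 = trans (cong (_* δ (T (x ⊕ h)) a) (trans (w-shift a-b a-b∈F x) w≡0)) (sym (cong (_* δ (T x) b) w≡0))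
        ... | no  w≢0 = cong₂ _*_ (w-shift a-b a-b∈F x) (trans (δ-congʳ (T-shift a-b a-b∈F x w≢0)) (δ-⇔
          (λ eq → ⊕-cancelʳ a-b (T x) b (≈-trans eq (≈-sym b+[a-b]≈a)))
          (λ eq → ≈-trans (⊕-congʳ eq) b+[a-b]≈a)))

      p*fibre : ∀ {a} → ∈F a → p * fibre a ≡ ∑ w
      p*fibre {a} a∈F = begin
        p * fibre a                     ≡⟨ cong (_* fibre a) p≡1+s ⟩
        fibre a + s * fibre a           ≡⟨ cong (_+ s * fibre a) (fibre-const a∈F 0∈F) ⟩
        fibre 0# + s * fibre a          ≡⟨ ∑-F fibre-cong (λ c c∈F _ → fibre-const c∈F a∈F) ⟨
        ∑ (λ c → φ c * fibre c)         ≡⟨ ∑-fibre ⟩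
        ∑ w                             ∎
        where open ≡-Reasoning

  -- The trace and the quadratic form

  Tr : Carrier → Carrier
  Tr = trace R p m

  sumBelow-cong : ∀ k {f g : ℕ → Carrier} → (∀ i → f i ≈ g i) → sumBelow R k f ≈ sumBelow R k g
  sumBelow-cong zero    f≈g = ≈-refl
  sumBelow-cong (suc k) f≈g = ⊕-cong (sumBelow-cong k f≈g) (f≈g k)

  sumBelow-⊕ : ∀ k (f g : ℕ → Carrier) → sumBelow R k (λ i → f i ⊕ g i) ≈ sumBelow R k f ⊕ sumBelow R k g
  sumBelow-⊕ zero    f g = ≈-sym (⊕-identityˡ 0#)
  sumBelow-⊕ (suc k) f g = ≈-trans (⊕-congʳ (sumBelow-⊕ k f g))
    (solve 4 (λ a b c d → (a :+ b) :+ (c :+ d) := (a :+ c) :+ (b :+ d)) ≈-refl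
      (sumBelow R k f) (sumBelow R k g) (f k) (g k))

  sumBelow-⊗ : ∀ k c (f : ℕ → Carrier) → sumBelow R k (λ i → c ⊗ f i) ≈ c ⊗ sumBelow R k f
  sumBelow-⊗ zero    c f = ≈-sym (⊗-zeroʳ c)
  sumBelow-⊗ (suc k) c f = ≈-trans (⊕-congʳ (sumBelow-⊗ k c f)) (≈-sym (⊗-distribˡ-⊕ c _ (f k)))

  Tr-cong : ∀ {x y} → x ≈ y → Tr x ≈ Tr y
  Tr-cong x≈y = sumBelow-cong m (λ i → ↑-congˡ (p ^ i) x≈y)

  Tr-⊕ : ∀ x y → Tr (x ⊕ y) ≈ Tr x ⊕ Tr y
  Tr-⊕ x y = ≈-trans (sumBelow-cong m (λ i → ↑p^i-⊕ i x y)) (sumBelow-⊕ m _ _)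

  F-↑p^i : ∀ i {c} → ∈F c → c ↑ (p ^ i) ≈ c
  F-↑p^i zero    {c} c∈F = ↑-1 c
  F-↑p^i (suc i) {c} c∈F = ≈-trans (≈-sym (↑-* c p (p ^ i))) (≈-trans (↑-congˡ (p ^ i) c∈F) (F-↑p^i i c∈F))

  Tr-⊗ : ∀ {c} → ∈F c → ∀ x → Tr (c ⊗ x) ≈ c ⊗ Tr x
  Tr-⊗ {c} c∈F x = ≈-trans
    (sumBelow-cong m (λ i → ≈-trans (↑-⊗ c x (p ^ i)) (⊗-congʳ (F-↑p^i i c∈F))))
    (sumBelow-⊗ m c (λ i → x ↑ (p ^ i)))

  ∈L : Carrier → Set
  ∈L x = x ↑ (p ^ m) ≈ x

  -- The p-th power moves each term of the trace to the next one, and `x ↑ (p ^ m) ≈ x` closes the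
  -- cycle. Adding x on both sides expresses this without subtraction.
  Tr∈F : ∀ {x} → ∈L x → ∈F (Tr x)
  Tr∈F {x} x∈L = ⊕-cancelˡ x _ _ (begin
    x ⊕ Tr x ↑ p                                 ≈⟨ ⊕-congˡ (↑p-sumBelow m) ⟩
    x ⊕ sumBelow R m (λ i → x ↑ (p ^ suc i))     ≈⟨ telescope m ⟩
    Tr x ⊕ x ↑ (p ^ m)                           ≈⟨ ⊕-congˡ x∈L ⟩
    Tr x ⊕ x                                     ≈⟨ ⊕-comm _ _ ⟩
    x ⊕ Tr x                                     ∎)
    where
    open ≈-Reasoning
    ↑p-sumBelow : ∀ k → sumBelow R k (λ i → x ↑ (p ^ i)) ↑ p ≈ sumBelow R k (λ i → x ↑ (p ^ suc i))
    ↑p-sumBelow zero    = 0∈F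
    ↑p-sumBelow (suc k) = ≈-trans (↑p-⊕ _ _) (⊕-cong (↑p-sumBelow k)
      (≈-trans (↑-* x (p ^ k) p) (↑-congʳ x (*-comm (p ^ k) p))))
    telescope : ∀ k → x ⊕ sumBelow R k (λ i → x ↑ (p ^ suc i)) ≈ sumBelow R k (λ i → x ↑ (p ^ i)) ⊕ x ↑ (p ^ k)
    telescope zero    = ≈-trans (⊕-comm _ _) (⊕-congˡ (≈-sym (↑-1 x)))
    telescope (suc k) = ≈-trans (≈-sym (⊕-assoc _ _ _)) (⊕-congʳ (telescope k))

  module _ where
    open ≈-Reasoning

    geometric : ∀ g k → 1# ⊕ g ⊗ S.sum {k} (λ j → g ↑ toℕ j) ≈ S.sum {k} (λ j → g ↑ toℕ j) ⊕ g ↑ k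
    geometric g zero    = ≈-trans (⊕-congˡ (⊗-zeroʳ g)) (⊕-comm 1# 0#)
    geometric g (suc k) = begin
      1# ⊕ g ⊗ G (suc k)                ≈⟨ ⊕-congˡ (⊗-congˡ G-suc) ⟩
      1# ⊕ g ⊗ (1# ⊕ g ⊗ G k)           ≈⟨ ⊕-congˡ (⊗-congˡ (geometric g k)) ⟩
      1# ⊕ g ⊗ (G k ⊕ g ↑ k)            ≈⟨ ⊕-congˡ (⊗-distribˡ-⊕ g _ _) ⟩
      1# ⊕ (g ⊗ G k ⊕ g ⊗ g ↑ k)        ≈⟨ ⊕-assoc 1# _ _ ⟨
      (1# ⊕ g ⊗ G k) ⊕ g ⊗ g ↑ k        ≈⟨ ⊕-congʳ G-suc ⟨
      G (suc k) ⊕ g ↑ suc k             ∎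
      where
      G : ℕ → Carrier
      G k = S.sum {k} (λ j → g ↑ toℕ j)
      G-suc : G (suc k) ≈ 1# ⊕ g ⊗ G k
      G-suc = ⊕-congˡ (≈-sym (S.*-distribˡ-sum g (λ (j : Fin k) → g ↑ toℕ j)))

    -- Multiplication by g permutes the terms cyclically, so g times the sum is the sum; a nonzero
    -- sum could be cancelled and would force g = 1.
    geometric-zero : ∀ g k → g ↑ k ≈ 1# → ¬ (g ≈ 1#) → S.sum {k} (λ j → g ↑ toℕ j) ≈ 0#
    geometric-zero g k gᵏ≈1 g≉1 with S.sum {k} (λ j → g ↑ toℕ j) ≟ 0#
    ... | yes e = e
    ... | no ¬e = contradiction (⊗-cancelˡ ¬e (≈-trans (⊗-comm _ g) (≈-trans gG≈G (≈-sym (⊗-identityʳ _))))) g≉1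
      where
      gG≈G : g ⊗ S.sum {k} (λ j → g ↑ toℕ j) ≈ S.sum {k} (λ j → g ↑ toℕ j)
      gG≈G = ⊕-cancelˡ 1# _ _ (≈-trans (geometric g k) (≈-trans (⊕-congˡ gᵏ≈1) (⊕-comm _ _)))

    sumBelow-first : ∀ k (f : ℕ → Carrier) → 0 < k → (∀ i → 0 < i → i < k → f i ≈ 0#) → sumBelow R k f ≈ f 0
    sumBelow-first (suc zero)    f _ _    = ⊕-identityˡ (f 0)
    sumBelow-first (suc (suc k)) f _ rest =
      ≈-trans (⊕-cong (sumBelow-first (suc k) f z<s (λ i i>0 i<k → rest i i>0 (m<n⇒m<1+n i<k))) (rest (suc k) z<s ≤-refl))
              (⊕-identityʳ (f 0))

    sum-sumBelow : ∀ l k (f : Fin l → ℕ → Carrier) →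
                   S.sum (λ j → sumBelow R k (f j)) ≈ sumBelow R k (λ i → S.sum (λ j → f j i))
    sum-sumBelow l zero    f = S.sum-replicate-zero l
    sum-sumBelow l (suc k) f = ≈-trans (S.∑-distrib-+ (λ j → sumBelow R k (f j)) (λ j → f j k)) (⊕-congʳ (sum-sumBelow l k f))

  ω : Carrier
  ω = α ↑ u

  ω-order : HasOrder ω M
  ω-order = HasOrder-↑ {s = M} (m≤n+m 1 (p ^ m)) (subst (HasOrder α) (sym uM≡n) α-prim)

  -- The inverse power of ω picks the linear term out of the trace: Σⱼ ω⁻ʲ Tr(ωʲ) = p^m − 1 ≠ 0 in the field.
  Tr-ω≢0 : ∃ λ (j : Fin M) → ¬ (Tr (ω ↑ toℕ j) ≈ 0#)
  Tr-ω≢0 = ¬∀⟶∃¬ M (λ j → Tr (ω ↑ toℕ j) ≈ 0#) (λ j → Tr (ω ↑ toℕ j) ≟ 0#) (λ all0 → M×1≉0 (begin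
    M ×ᴿ 1#
      ≈⟨ ≈-sym first ⟩
    G 0
      ≈⟨ sumBelow-first m G 0<m later ⟨
    sumBelow R m G
      ≈⟨ sumBelow-cong m (λ i → S.sum-cong-≋ (λ (j : Fin M) → regroup (toℕ j) i)) ⟩
    sumBelow R m (λ i → S.sum {M} (λ j → ω ↑ (toℕ j * M′) ⊗ (ω ↑ toℕ j) ↑ (p ^ i)))
      ≈⟨ sum-sumBelow M m (λ j i → ω ↑ (toℕ j * M′) ⊗ (ω ↑ toℕ j) ↑ (p ^ i)) ⟨
    S.sum {M} (λ j → sumBelow R m (λ i → ω ↑ (toℕ j * M′) ⊗ (ω ↑ toℕ j) ↑ (p ^ i)))
      ≈⟨ S.sum-cong-≋ {M} (λ j → ≈-trans (sumBelow-⊗ m _ _) (≈-trans (⊗-congˡ (all0 j)) (⊗-zeroʳ _))) ⟩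
    S.sum {M} (λ _ → 0#)
      ≈⟨ S.sum-replicate-zero M ⟩
    0#
      ∎))
    where
    open ≈-Reasoning
    M′ = M ∸ 1
    M≡1+M′ : M ≡ suc M′
    M≡1+M′ = sym (m+[n∸m]≡n M>0)
    G : ℕ → Carrier
    G i = S.sum {M} (λ j → (ω ↑ (M′ + p ^ i)) ↑ toℕ j)

    M×1≉0 : ¬ (M ×ᴿ 1# ≈ 0#)
    M×1≉0 e = 1≉0 (begin
      1#                  ≈⟨ ⊕-identityʳ 1# ⟨
      1# ⊕ 0#             ≈⟨ ⊕-congˡ e ⟨
      suc M ×ᴿ 1#         ≡⟨ cong (_×ᴿ 1#) (p^k≡1+ m) ⟨
      (p ^ m) ×ᴿ 1#       ≈⟨ ^×1 p m ⟩
      (p ×ᴿ 1#) ↑ m       ≈⟨ ↑-congˡ m char ⟩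
      0# ↑ m              ≈⟨ 0↑ m 0<m ⟩
      0#                  ∎)

    first : G 0 ≈ M ×ᴿ 1#
    first = ≈-trans (S.sum-cong-≋ {M} (λ j → ≈-trans (↑-congˡ (toℕ j) one) (1↑ (toℕ j)))) (S.sum-replicate M)
      where
      one : ω ↑ (M′ + 1) ≈ 1#
      one = ≈-trans (↑-congʳ ω (trans (+-comm M′ 1) (sym M≡1+M′))) (proj₁ ω-order)

    -- The exponent `M′ + p ^ i` equals M + (p^i - 1) with 0 < p^i - 1 < M, so this power of `ω` is
    -- not 1 and the geometric sum vanishes.
    later : ∀ i → 0 < i → i < m → G i ≈ 0#
    later i i>0 i<m = geometric-zero (ω ↑ (M′ + p ^ i)) M
      (≈-trans (↑-*′ ω (M′ + p ^ i) M) (≈-trans (↑-congˡ (M′ + p ^ i) (proj₁ ω-order)) (1↑ (M′ + p ^ i))))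
      (λ e → <⇒≱ k<M (∣⇒≤ {{>-nonZero (m<n⇒0<n∸m (p^k>1 i>0))}}
        (∣m+n∣m⇒∣n (subst (M ∣_) M′+p^i≡M+k (order-∣ M>0 ω-order (M′ + p ^ i) e)) ∣-refl)))
      where
      k = p ^ i ∸ 1
      k<M : k < M
      k<M = ∸-monoˡ-< (^-monoʳ-< p 1<p i<m) (m^n>0 p i)
      M′+p^i≡M+k : M′ + p ^ i ≡ M + k
      M′+p^i≡M+k = trans (cong (M′ +_) (p^k≡1+ i)) (trans (+-suc M′ k) (cong (_+ k) (sym M≡1+M′)))

    regroup : ∀ j i → (ω ↑ (M′ + p ^ i)) ↑ j ≈ ω ↑ (j * M′) ⊗ (ω ↑ j) ↑ (p ^ i)
    regroup j i = begin
      (ω ↑ (M′ + p ^ i)) ↑ j                  ≈⟨ ↑-* ω (M′ + p ^ i) j ⟩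
      ω ↑ ((M′ + p ^ i) * j)                  ≡⟨ cong (ω ↑_) (trans (*-comm _ j) (*-distribˡ-+ j M′ (p ^ i))) ⟩
      ω ↑ (j * M′ + j * p ^ i)                ≈⟨ ↑-+ ω (j * M′) (j * p ^ i) ⟩
      ω ↑ (j * M′) ⊗ ω ↑ (j * p ^ i)          ≈⟨ ⊗-congˡ (↑-* ω j (p ^ i)) ⟨
      ω ↑ (j * M′) ⊗ (ω ↑ j) ↑ (p ^ i)        ∎

  -- Conjugation over GF(p^m), the norm and the polar form

  conj : Carrier → Carrier
  conj x = x ↑ (p ^ m)

  conj-cong : ∀ {x y} → x ≈ y → conj x ≈ conj y
  conj-cong = ↑-congˡ (p ^ m)

  conj-⊕ : ∀ x y → conj (x ⊕ y) ≈ conj x ⊕ conj y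
  conj-⊕ = ↑p^i-⊕ m

  conj-⊗ : ∀ x y → conj (x ⊗ y) ≈ conj x ⊗ conj y
  conj-⊗ x y = ↑-⊗ x y (p ^ m)

  conj-conj : ∀ x → conj (conj x) ≈ x
  conj-conj x = ≈-trans (↑-* x (p ^ m) (p ^ m)) (≈-trans (↑-congʳ x p^m*p^m≡q) (↑-order x))
    where
    p^m*p^m≡q : p ^ m * p ^ m ≡ p ^ (2 * m)
    p^m*p^m≡q = trans (sym (^-distribˡ-+-* p m m)) (cong (λ z → p ^ (m + z)) (sym (+-identityʳ m)))

  conj-F : ∀ {c} → ∈F c → conj c ≈ c
  conj-F = F-↑p^i m

  Nm : Carrier → Carrier
  Nm x = x ↑ u

  Nm≈ : ∀ x → Nm x ≈ conj x ⊗ x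
  Nm≈ x = ≈-trans (↑-+ x (p ^ m) 1) (⊗-congˡ (↑-1 x))

  Nm∈L : ∀ x → ∈L (Nm x)
  Nm∈L x = begin
    conj (Nm x)                 ≈⟨ conj-cong (Nm≈ x) ⟩
    conj (conj x ⊗ x)           ≈⟨ conj-⊗ _ _ ⟩
    conj (conj x) ⊗ conj x      ≈⟨ ⊗-congʳ (conj-conj x) ⟩
    x ⊗ conj x                  ≈⟨ ⊗-comm _ _ ⟩
    conj x ⊗ x                  ≈⟨ Nm≈ x ⟨
    Nm x                        ∎
    where open ≈-Reasoning

  x⊕conj∈L : ∀ x → ∈L (x ⊕ conj x)
  x⊕conj∈L x = ≈-trans (conj-⊕ x _) (≈-trans (⊕-congˡ (conj-conj x)) (⊕-comm _ _))

  Q : Carrier → Carrier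
  Q x = Tr (Nm x)

  -- The Hermitian form of GF(p^(2m)) over GF(p^m). Adding its conjugate takes the relative trace to
  -- GF(p^m), from which `Tr` descends to GF(p).
  polar : Carrier → Carrier → Carrier
  polar x y = x ⊗ conj y

  B : Carrier → Carrier → Carrier
  B x y = Tr (polar x y ⊕ conj (polar x y))

  Q-cong : ∀ {x y} → x ≈ y → Q x ≈ Q y
  Q-cong e = Tr-cong (↑-congˡ u e)

  B-cong : ∀ {x x′ y y′} → x ≈ x′ → y ≈ y′ → B x y ≈ B x′ y′
  B-cong e e′ = Tr-cong (⊕-cong polar≈ (conj-cong polar≈))
    where polar≈ = ⊗-cong e (conj-cong e′)

  Q∈F : ∀ x → ∈F (Q x)
  Q∈F x = Tr∈F (Nm∈L x)

  B∈F : ∀ x y → ∈F (B x y)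
  B∈F x y = Tr∈F (x⊕conj∈L (polar x y))

  Tr-0 : Tr 0# ≈ 0#
  Tr-0 = ≈-trans (Tr-cong (≈-sym (⊗-zeroˡ 0#))) (≈-trans (Tr-⊗ 0∈F 0#) (⊗-zeroˡ _))

  Q-0 : Q 0# ≈ 0#
  Q-0 = ≈-trans (Tr-cong (0↑ u (m≤n+m 1 (p ^ m)))) Tr-0

  Q-⊕ : ∀ x y → Q (x ⊕ y) ≈ (Q x ⊕ B x y) ⊕ Q y
  Q-⊕ x y = begin
    Tr (Nm (x ⊕ y))                        ≈⟨ Tr-cong expand ⟩
    Tr ((Nm x ⊕ (v ⊕ conj v)) ⊕ Nm y)      ≈⟨ Tr-⊕ _ _ ⟩
    Tr (Nm x ⊕ (v ⊕ conj v)) ⊕ Q y         ≈⟨ ⊕-congʳ (Tr-⊕ _ _) ⟩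
    (Q x ⊕ B x y) ⊕ Q y                    ∎
    where
    open ≈-Reasoning
    v = polar x y
    conj-v : conj v ≈ conj x ⊗ y
    conj-v = ≈-trans (conj-⊗ x (conj y)) (⊗-congˡ (conj-conj y))
    expand : Nm (x ⊕ y) ≈ (Nm x ⊕ (v ⊕ conj v)) ⊕ Nm y
    expand = begin
      Nm (x ⊕ y)                              ≈⟨ Nm≈ _ ⟩
      conj (x ⊕ y) ⊗ (x ⊕ y)                  ≈⟨ ⊗-congʳ (conj-⊕ x y) ⟩
      (conj x ⊕ conj y) ⊗ (x ⊕ y)
        ≈⟨ solve 4 (λ a b c d → (c :+ d) :* (a :+ b) := (c :* a :+ (a :* d :+ c :* b)) :+ d :* b) ≈-refl x y (conj x) (conj y) ⟩
      (conj x ⊗ x ⊕ (x ⊗ conj y ⊕ conj x ⊗ y)) ⊕ conj y ⊗ y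
        ≈⟨ ⊕-cong (⊕-cong (Nm≈ x) (⊕-congˡ conj-v)) (Nm≈ y) ⟨
      (Nm x ⊕ (v ⊕ conj v)) ⊕ Nm y            ∎

  B-⊕ : ∀ x y d → B (x ⊕ y) d ≈ B x d ⊕ B y d
  B-⊕ x y d = ≈-trans (Tr-cong expand) (Tr-⊕ (polar x d ⊕ conj (polar x d)) (polar y d ⊕ conj (polar y d)))
    where
    open ≈-Reasoning
    polar-⊕ : polar (x ⊕ y) d ≈ polar x d ⊕ polar y d
    polar-⊕ = ⊗-distribʳ-⊕ (conj d) x y
    expand : polar (x ⊕ y) d ⊕ conj (polar (x ⊕ y) d) ≈ (polar x d ⊕ conj (polar x d)) ⊕ (polar y d ⊕ conj (polar y d))
    expand = begin
      polar (x ⊕ y) d ⊕ conj (polar (x ⊕ y) d)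
        ≈⟨ ⊕-cong polar-⊕ (≈-trans (conj-cong polar-⊕) (conj-⊕ (polar x d) (polar y d))) ⟩
      (polar x d ⊕ polar y d) ⊕ (conj (polar x d) ⊕ conj (polar y d))
        ≈⟨ solve 4 (λ a b c d → (a :+ b) :+ (c :+ d) := (a :+ c) :+ (b :+ d)) ≈-refl
             (polar x d) (polar y d) (conj (polar x d)) (conj (polar y d)) ⟩
      (polar x d ⊕ conj (polar x d)) ⊕ (polar y d ⊕ conj (polar y d)) ∎

  private
    Tr-symm-⊗ : ∀ {c} → ∈F c → ∀ v → Tr (c ⊗ v ⊕ conj (c ⊗ v)) ≈ c ⊗ Tr (v ⊕ conj v)
    Tr-symm-⊗ {c} c∈F v = ≈-trans
      (Tr-cong (≈-trans (⊕-congˡ (≈-trans (conj-⊗ c v) (⊗-congʳ (conj-F c∈F)))) (≈-sym (⊗-distribˡ-⊕ c v (conj v)))))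
      (Tr-⊗ c∈F _)

  B-⊗ˡ : ∀ {c} → ∈F c → ∀ x d → B (c ⊗ x) d ≈ c ⊗ B x d
  B-⊗ˡ {c} c∈F x d = ≈-trans (Tr-cong (⊕-cong polar≈ (conj-cong polar≈))) (Tr-symm-⊗ c∈F (polar x d))
    where
    polar≈ : polar (c ⊗ x) d ≈ c ⊗ polar x d
    polar≈ = ⊗-assoc c x (conj d)

  B-⊗ʳ : ∀ {c} → ∈F c → ∀ x d → B x (c ⊗ d) ≈ c ⊗ B x d
  B-⊗ʳ {c} c∈F x d = ≈-trans (Tr-cong (⊕-cong polar≈ (conj-cong polar≈))) (Tr-symm-⊗ c∈F (polar x d))
    where
    polar≈ : polar x (c ⊗ d) ≈ c ⊗ polar x d
    polar≈ = ≈-trans (⊗-congˡ (≈-trans (conj-⊗ c d) (⊗-congʳ (conj-F c∈F))))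
      (solve 3 (λ x c d → x :* (c :* d) := c :* (x :* d)) ≈-refl x c (conj d))

  B-self : ∀ d → B d d ≈ Q d ⊕ Q d
  B-self d = ≈-trans (Tr-cong (⊕-cong polar≈Nm (≈-trans (conj-cong polar≈Nm) (Nm∈L d)))) (Tr-⊕ _ _)
    where
    polar≈Nm : polar d d ≈ Nm d
    polar≈Nm = ≈-trans (⊗-comm _ _) (≈-sym (Nm≈ d))

  Q-⊗ : ∀ {c} → ∈F c → ∀ x → Q (c ⊗ x) ≈ (c ⊗ c) ⊗ Q x
  Q-⊗ {c} c∈F x = ≈-trans
    (Tr-cong (≈-trans (↑-⊗ c x u) (⊗-congʳ (≈-trans (Nm≈ c) (⊗-congʳ (conj-F c∈F))))))
    (Tr-⊗ (⊗∈F c∈F c∈F) _)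

  -- Scaling by c in GF(p) multiplies Q by c², hence reaches square factors only. Scaling by an
  -- element of norm c multiplies Q by c itself, so nonsquare factors are reached too.
  Q-Nm-⊗ : ∀ {c v} → ∈F c → Nm v ≈ c → ∀ x → Q (v ⊗ x) ≈ c ⊗ Q x
  Q-Nm-⊗ {c} {v} c∈F e x = ≈-trans (Tr-cong (≈-trans (↑-⊗ v x u) (⊗-congʳ e))) (Tr-⊗ c∈F _)

  -- A nonzero element of GF(p) lies in GF(p^m) and so is a power of `α ↑ u`, which is the norm of a
  -- power of `α`.
  Nm-surjective : ∀ {c} → ∈F c → ¬ (c ≈ 0#) → ∃ λ v → Nm v ≈ c
  Nm-surjective {c} c∈F c≉0 = α ↑ proj₁ power , ≈-trans (↑-* α (proj₁ power) u) (proj₂ power)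
    where
    c∈L : c ↑ suc M ≈ c
    c∈L = ≈-trans (↑-congʳ c (sym (p^k≡1+ m))) (conj-F c∈F)
    power : ∃ λ j → α ↑ (j * u) ≈ c
    power = 𝕃.fixed-is-power c c≉0 c∈L

  2# : Carrier
  2# = 1# ⊕ 1#

  2∈F : ∈F 2#
  2∈F = ⊕∈F 1∈F 1∈F

  x⊕x≈2x : ∀ x → x ⊕ x ≈ 2# ⊗ x
  x⊕x≈2x x = ≈-sym (≈-trans (⊗-distribʳ-⊕ x 1# 1#) (⊕-cong (⊗-identityˡ x) (⊗-identityˡ x)))

  -- As p is 1 + 2 (p / 2), the equation 2 = 0 would turn `p ×ᴿ 1# ≈ 0#` into 1 = 0.
  2≉0 : ¬ (2# ≈ 0#)
  2≉0 2≈0 = 1≉0 (begin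
    1#                                       ≈⟨ ⊕-identityʳ 1# ⟨
    1# ⊕ 0#                                  ≈⟨ ⊕-congˡ (⊗-zeroʳ _) ⟨
    1# ⊕ ((p / 2) ×ᴿ 1#) ⊗ 0#                ≈⟨ ⊕-congˡ (⊗-congˡ (≈-trans (⊕-congˡ (⊕-identityʳ 1#)) 2≈0)) ⟨
    1# ⊕ ((p / 2) ×ᴿ 1#) ⊗ (2 ×ᴿ 1#)         ≈⟨ ⊕-congˡ (×1-homo-* (p / 2) 2) ⟨
    suc (p / 2 * 2) ×ᴿ 1#                    ≡⟨ cong (_×ᴿ 1#) (trans (m≡m%n+[m/n]*n p 2) (cong (_+ p / 2 * 2) p-odd)) ⟨
    p ×ᴿ 1#                                  ≈⟨ char ⟩
    0#                                       ∎)
    where open ≈-Reasoning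

  -- An element with nonzero trace, divided by that trace: the trace lies in GF(p), so linearity
  -- applies to its inverse.
  Tr-one : ∃ λ z → ∈L z × Tr z ≈ 1#
  Tr-one = c ⊗ z , ≈-trans (conj-⊗ c z) (⊗-cong (conj-F c∈F) z∈L) ,
    ≈-trans (Tr-⊗ c∈F z) (≈-trans (⊗-comm c (Tr z)) (proj₂ c-inverse))
    where
    z : Carrier
    z = ω ↑ toℕ (proj₁ Tr-ω≢0)
    z∈L : ∈L z
    z∈L = ≈-trans (↑-*′ ω (toℕ (proj₁ Tr-ω≢0)) (p ^ m)) (↑-congˡ (toℕ (proj₁ Tr-ω≢0)) (Nm∈L α))
    c-inverse : ∃ λ c → Tr z ⊗ c ≈ 1#
    c-inverse = inverse (Tr z) (proj₂ Tr-ω≢0)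
    c : Carrier
    c = proj₁ c-inverse
    c∈F : ∈F c
    c∈F = inverse∈F (Tr∈F z∈L) (proj₂ c-inverse) (proj₂ Tr-ω≢0)

  -- The witness is z / (2 conj d). Its polar product with d is z / 2, which lies in GF(p^m), so
  -- adding the conjugate gives back z.
  B-dual : ∀ {d d′ h z} → conj d ⊗ d′ ≈ 1# → 2# ⊗ h ≈ 1# → ∈L z → Tr z ≈ 1# → B ((h ⊗ z) ⊗ d′) d ≈ 1#
  B-dual {d} {d′} {h} {z} dd′≈1 2h≈1 z∈L Tr-z = ≈-trans (Tr-cong arg≈z) Tr-z
    where
    open ≈-Reasoning
    v : Carrier
    v = polar ((h ⊗ z) ⊗ d′) d
    v≈ : v ≈ h ⊗ z
    v≈ = ≈-trans (⊗-assoc (h ⊗ z) d′ (conj d))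
      (≈-trans (⊗-congˡ (≈-trans (⊗-comm d′ (conj d)) dd′≈1)) (⊗-identityʳ (h ⊗ z)))
    hz∈L : ∈L (h ⊗ z)
    hz∈L = ≈-trans (conj-⊗ h z) (⊗-cong (conj-F (inverse∈F 2∈F 2h≈1 2≉0)) z∈L)
    arg≈z : v ⊕ conj v ≈ z
    arg≈z = begin
      v ⊕ conj v          ≈⟨ ⊕-cong v≈ (≈-trans (conj-cong v≈) hz∈L) ⟩
      h ⊗ z ⊕ h ⊗ z       ≈⟨ x⊕x≈2x (h ⊗ z) ⟩
      2# ⊗ (h ⊗ z)        ≈⟨ ⊗-assoc 2# h z ⟨
      (2# ⊗ h) ⊗ z        ≈⟨ ⊗-congʳ 2h≈1 ⟩
      1# ⊗ z              ≈⟨ ⊗-identityˡ z ⟩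
      z                   ∎

  B-nondegenerate : ∀ {d} → ¬ (d ≈ 0#) → ∃ λ t → B t d ≈ 1#
  B-nondegenerate {d} d≉0 = _ , B-dual (proj₂ (inverse (conj d) (↑-≉0 (p ^ m) d≉0)))
    (proj₂ (inverse 2# 2≉0)) (proj₁ (proj₂ Tr-one)) (proj₂ (proj₂ Tr-one))

  -- Zeros of the form on the hyperplanes B(y,d) = c

  P : ℕ
  P = p ^ (m ∸ 1)

  m≡1+ : m ≡ suc (m ∸ 1)
  m≡1+ = sym (m+[n∸m]≡n 0<m)

  p^m≡ : p ^ m ≡ p * P
  p^m≡ = cong (p ^_) m≡1+

  2m≡ : 2 * m ≡ 2 + ((m ∸ 1) + (m ∸ 1))
  2m≡ = trans (cong (2 *_) m≡1+) (double (m ∸ 1))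
    where
    double : ∀ k → 2 * suc k ≡ 2 + (k + k)
    double = solve-∀

  p^[2m-2]≡ : p ^ (2 * m ∸ 2) ≡ P * P
  p^[2m-2]≡ = trans (cong (λ k → p ^ (k ∸ 2)) 2m≡) (^-distribˡ-+-* p (m ∸ 1) (m ∸ 1))

  p^[2m-1]≡ : p ^ (2 * m ∸ 1) ≡ p * (P * P)
  p^[2m-1]≡ = trans (cong (λ k → p ^ (k ∸ 1)) 2m≡) (cong (p *_) (^-distribˡ-+-* p (m ∸ 1) (m ∸ 1)))

  p^[2m]≡ : p ^ (2 * m) ≡ p * (p * (P * P))
  p^[2m]≡ = trans (cong (p ^_) 2m≡) (cong (λ k → p * (p * k)) (^-distribˡ-+-* p (m ∸ 1) (m ∸ 1)))

  ∑-scale : ∀ {v} → ¬ (v ≈ 0#) → ∀ {f} → Congruent f → ∑ (λ x → f (v ⊗ x)) ≡ ∑ f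
  ∑-scale {v} v≉0 =
    ∑-bij (v ⊗_) (v′ ⊗_) ⊗-congˡ ⊗-congˡ (λ x → undo vv′≈1 x) (λ x → undo (≈-trans (⊗-comm v′ v) vv′≈1) x)
    where
    v′ = proj₁ (inverse v v≉0)
    vv′≈1 = proj₂ (inverse v v≉0)
    undo : ∀ {a b} → a ⊗ b ≈ 1# → ∀ x → a ⊗ (b ⊗ x) ≈ x
    undo ab≈1 x = ≈-trans (≈-sym (⊗-assoc _ _ x)) (≈-trans (⊗-congʳ ab≈1) (⊗-identityˡ x))

  1*∑ : ∀ (f : Carrier → ℕ) → ∑ (λ x → 1 * f x) ≡ ∑ f
  1*∑ f = ∑-cong {λ x → 1 * f x} {f} (λ x → *-identityˡ (f x))

  -- The `α ↑ (j * u)` are the nonzero elements of GF(p^m), so the kernel of the trace there has one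
  -- element more than this.
  trace-zeros : ℕ
  trace-zeros = ∑< M (λ j → δ (Tr (α ↑ (j * u))) 0#)

  -- Translation by c z with Tr z = 1 preserves GF(p^m) and raises the trace by c, so the kernel is
  -- a p-th part of GF(p^m).
  1+trace-zeros≡P : suc trace-zeros ≡ P
  1+trace-zeros≡P = *-cancelˡ-≡ (suc trace-zeros) P p (begin
    p * suc trace-zeros
      ≡⟨ cong (p *_) kernel ⟨
    p * fibre 0#
      ≡⟨ Shift.p*fibre z w-shift (λ c c∈F x _ → T-shift c c∈F x) 0∈F ⟩
    ∑ w
      ≡⟨ ∑-cong (λ x → trans (w≡ x) (sym (*-identityʳ _))) ⟩
    ∑ (λ x → δ (x ↑ suc M) x * 1)
      ≡⟨ 𝕃.∑-fixed (λ _ → refl) ⟩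
    1 + ∑< M (λ _ → 1)
      ≡⟨ cong suc (trans (sum-const M 1) (*-identityʳ M)) ⟩
    suc M
      ≡⟨ trans (sym (p^k≡1+ m)) p^m≡ ⟩
    p * P ∎)
    where
    open ≡-Reasoning
    z : Carrier
    z = proj₁ Tr-one
    z∈L : ∈L z
    z∈L = proj₁ (proj₂ Tr-one)
    Tr-z : Tr z ≈ 1#
    Tr-z = proj₂ (proj₂ Tr-one)
    w : Carrier → ℕ
    w x = δ (conj x) x
    w≡ : ∀ x → w x ≡ δ (x ↑ suc M) x
    w≡ x = cong (λ k → δ (x ↑ k) x) (p^k≡1+ m)
    open Weighted w (λ x≈y → δ-cong (conj-cong x≈y) x≈y) Tr Tr-cong (λ x w≢0 → Tr∈F (δ≢0 w≢0))
    kernel : fibre 0# ≡ suc trace-zeros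
    kernel = begin
      ∑ (λ x → w x * δ (Tr x) 0#)                   ≡⟨ ∑-cong (λ x → cong (_* δ (Tr x) 0#) (w≡ x)) ⟩
      ∑ (λ x → δ (x ↑ suc M) x * δ (Tr x) 0#)       ≡⟨ 𝕃.∑-fixed (λ x≈y → δ-congʳ (Tr-cong x≈y)) ⟩
      δ (Tr 0#) 0# + trace-zeros                    ≡⟨ cong (_+ trace-zeros) (δ-yes Tr-0) ⟩
      suc trace-zeros                               ∎
    w-shift : ∀ c → ∈F c → ∀ x → w (x ⊕ c ⊗ z) ≡ w x
    w-shift c c∈F x = δ-⇔
      (λ eq → ⊕-cancelʳ (c ⊗ z) (conj x) x (≈-trans (≈-sym conj-shift) eq))
      (λ eq → ≈-trans conj-shift (⊕-congʳ eq))
      where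
      conj-shift : conj (x ⊕ c ⊗ z) ≈ conj x ⊕ c ⊗ z
      conj-shift = ≈-trans (conj-⊕ _ _) (⊕-congˡ (≈-trans (conj-⊗ c z) (⊗-cong (conj-F c∈F) z∈L)))
    T-shift : ∀ c → ∈F c → ∀ x → Tr (x ⊕ c ⊗ z) ≈ Tr x ⊕ c
    T-shift c c∈F x = ≈-trans (Tr-⊕ _ _) (⊕-congˡ (≈-trans (Tr-⊗ c∈F z) (≈-trans (⊗-congˡ Tr-z) (⊗-identityʳ c))))

  Q-zeros : ℕ
  Q-zeros = ∑ (λ x → δ (Q x) 0#)

  -- The norm takes each nonzero value in GF(p^m) exactly u = p^m + 1 times, so with 0 there are 1 +
  -- (p P + 1)(P - 1) zeros.
  Q-zeros+P*s≡ : Q-zeros + P * s ≡ p * (P * P)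
  Q-zeros+P*s≡ = begin
    Q-zeros + P * s
      ≡⟨ cong (_+ P * s) (𝕃.∑-power-map (λ x≈y → δ-congʳ (Tr-cong x≈y))) ⟩
    (δ (Tr 0#) 0# + u * trace-zeros) + P * s
      ≡⟨ cong₂ (λ a b → (a + (b + 1) * trace-zeros) + P * s) (δ-yes Tr-0) (trans p^m≡ (cong (_* P) p≡1+s)) ⟩
    (1 + (suc s * P + 1) * trace-zeros) + P * s
      ≡⟨ cong (λ z → (1 + (suc s * z + 1) * trace-zeros) + z * s) 1+trace-zeros≡P ⟨
    (1 + (suc s * suc trace-zeros + 1) * trace-zeros) + suc trace-zeros * s
      ≡⟨ identity s trace-zeros ⟩
    suc s * (suc trace-zeros * suc trace-zeros)
      ≡⟨ cong₂ (λ a b → a * (b * b)) (sym p≡1+s) 1+trace-zeros≡P ⟩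
    p * (P * P) ∎
    where
    open ≡-Reasoning
    identity : ∀ s t → (1 + (suc s * suc t + 1) * t) + suc t * s ≡ suc s * (suc t * suc t)
    identity = solve-∀

  B-0ˡ : ∀ d → B 0# d ≈ 0#
  B-0ˡ d = ≈-trans (B-cong (≈-sym (⊗-zeroˡ 0#)) ≈-refl) (≈-trans (B-⊗ˡ 0∈F 0# d) (⊗-zeroˡ _))

  B-shift : ∀ {l} → ∈F l → ∀ x y d → B (x ⊕ l ⊗ y) d ≈ B x d ⊕ l ⊗ B y d
  B-shift l∈F x y d = ≈-trans (B-⊕ _ _ d) (⊕-congˡ (B-⊗ˡ l∈F y d))

  Q-shift : ∀ {l} → ∈F l → ∀ x d → Q (x ⊕ l ⊗ d) ≈ (Q x ⊕ l ⊗ B x d) ⊕ (l ⊗ l) ⊗ Q d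
  Q-shift l∈F x d = ≈-trans (Q-⊕ _ _) (⊕-cong (⊕-congˡ (B-⊗ʳ l∈F x d)) (Q-⊗ l∈F d))

  module Direction (d : Carrier) (d≉0 : ¬ (d ≈ 0#)) where

    module ByB = Weighted (λ y → δ (Q y) 0#) (λ x≈y → δ-congʳ (Q-cong x≈y))
                          (λ y → B y d) (λ x≈y → B-cong x≈y ≈-refl) (λ y _ → B∈F y d)

    N : Carrier → ℕ
    N = ByB.fibre

    N-const : ∀ c → ∈F c → ¬ (c ≈ 0#) → N c ≡ N 1#
    N-const c c∈F c≉0 = begin
      ∑ (λ y → δ (Q y) 0# * δ (B y d) c)
        ≡⟨ ∑-scale c≉0 (λ x≈y → cong₂ _*_ (δ-congʳ (Q-cong x≈y)) (δ-congʳ (B-cong x≈y ≈-refl))) ⟨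
      ∑ (λ y → δ (Q (c ⊗ y)) 0# * δ (B (c ⊗ y) d) c)
        ≡⟨ ∑-cong (λ y → cong₂ _*_ (Q-part y) (B-part y)) ⟩
      ∑ (λ y → δ (Q y) 0# * δ (B y d) 1#) ∎
      where
      open ≡-Reasoning
      Q-part : ∀ y → δ (Q (c ⊗ y)) 0# ≡ δ (Q y) 0#
      Q-part y = δ-⇔ (λ e → ⊗-≈0 (≈-trans (≈-sym (Q-⊗ c∈F y)) e) (⊗-≉0 c≉0 c≉0))
                     (λ e → ≈-trans (Q-⊗ c∈F y) (≈-trans (⊗-congˡ e) (⊗-zeroʳ _)))
      B-part : ∀ y → δ (B (c ⊗ y) d) c ≡ δ (B y d) 1#
      B-part y = δ-⇔ (λ e → ⊗-cancelˡ c≉0 (≈-trans (≈-sym (B-⊗ˡ c∈F y d)) (≈-trans e (≈-sym (⊗-identityʳ c)))))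
                     (λ e → ≈-trans (B-⊗ˡ c∈F y d) (≈-trans (⊗-congˡ e) (⊗-identityʳ c)))

    N-total : N 0# + s * N 1# ≡ Q-zeros
    N-total = trans (sym (∑-F ByB.fibre-cong N-const)) ByB.∑-fibre

    -- By nondegeneracy some t has B(t,d) = 1, and translation along t makes the values of B(·,d)
    -- equidistributed.
    B-fibre : ∀ {c} → ∈F c → ∑ (λ y → δ (B y d) c) ≡ p * (P * P)
    B-fibre {c} c∈F = *-cancelˡ-≡ _ _ p (begin
      p * ∑ (λ y → δ (B y d) c)    ≡⟨ cong (p *_) (1*∑ (λ y → δ (B y d) c)) ⟨
      p * W.fibre c                ≡⟨ W.Shift.p*fibre t (λ _ _ _ → refl) (λ l l∈F x _ → shift l∈F x) c∈F ⟩
      ∑ (λ _ → 1)                  ≡⟨ trans ∑-one p^[2m]≡ ⟩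
      p * (p * (P * P))            ∎)
      where
      open ≡-Reasoning
      module W = Weighted (λ _ → 1) (λ _ → refl) (λ y → B y d) (λ x≈y → B-cong x≈y ≈-refl) (λ y _ → B∈F y d)
      t : Carrier
      t = proj₁ (B-nondegenerate d≉0)
      Bt≈1 : B t d ≈ 1#
      Bt≈1 = proj₂ (B-nondegenerate d≉0)
      shift : ∀ {l} → ∈F l → ∀ x → B (x ⊕ l ⊗ t) d ≈ B x d ⊕ l
      shift l∈F x = ≈-trans (B-shift l∈F x t d) (⊕-congˡ (≈-trans (⊗-congˡ Bt≈1) (⊗-identityʳ _)))

    module Singular (Qd≈0 : Q d ≈ 0#) where

      -- Here the hyperplane B(y,d) = 1 is the weight and Q the map. Since B(d,d) = 2 Q(d) = 0,
      -- translation by l d stays on the hyperplane, and there it raises Q by exactly l.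
      N1≡ : N 1# ≡ P * P
      N1≡ = *-cancelˡ-≡ _ _ p (begin
        p * N 1#               ≡⟨ cong (p *_) (∑-cong (λ y → *-comm (δ (Q y) 0#) (δ (B y d) 1#))) ⟩
        p * W.fibre 0#         ≡⟨ W.Shift.p*fibre d w-shift T-shift 0∈F ⟩
        ∑ (λ y → δ (B y d) 1#) ≡⟨ B-fibre 1∈F ⟩
        p * (P * P)            ∎)
        where
        open ≡-Reasoning
        module W = Weighted (λ y → δ (B y d) 1#) (λ x≈y → δ-congʳ (B-cong x≈y ≈-refl)) Q Q-cong (λ y _ → Q∈F y)
        Bdd≈0 : B d d ≈ 0#
        Bdd≈0 = ≈-trans (B-self d) (≈-trans (⊕-cong Qd≈0 Qd≈0) (⊕-identityˡ 0#))
        w-shift : ∀ l → ∈F l → ∀ x → δ (B (x ⊕ l ⊗ d) d) 1# ≡ δ (B x d) 1#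
        w-shift l l∈F x = δ-congʳ (≈-trans (B-shift l∈F x d d)
          (≈-trans (⊕-congˡ (≈-trans (⊗-congˡ Bdd≈0) (⊗-zeroʳ l))) (⊕-identityʳ _)))
        T-shift : ∀ l → ∈F l → ∀ x → δ (B x d) 1# ≢ 0 → Q (x ⊕ l ⊗ d) ≈ Q x ⊕ l
        T-shift l l∈F x w≢0 = ≈-trans (Q-shift l∈F x d) (≈-trans
          (⊕-cong (⊕-congˡ (≈-trans (⊗-congˡ (δ≢0 w≢0)) (⊗-identityʳ l))) (≈-trans (⊗-congˡ Qd≈0) (⊗-zeroʳ _)))
          (⊕-identityʳ _))

      N0+P*s≡ : N 0# + P * s ≡ P * P
      N0+P*s≡ = +-cancelʳ-≡ (s * (P * P)) _ _ (begin
        (N 0# + P * s) + s * (P * P)       ≡⟨ rearrange (N 0#) (P * s) (s * (P * P)) ⟩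
        (N 0# + s * (P * P)) + P * s       ≡⟨ cong (λ z → (N 0# + s * z) + P * s) N1≡ ⟨
        (N 0# + s * N 1#) + P * s          ≡⟨ cong (_+ P * s) N-total ⟩
        Q-zeros + P * s                    ≡⟨ Q-zeros+P*s≡ ⟩
        p * (P * P)                        ≡⟨ cong (_* (P * P)) p≡1+s ⟩
        P * P + s * (P * P)                ∎)
        where
        open ≡-Reasoning
        rearrange : ∀ a b c → (a + b) + c ≡ (a + c) + b
        rearrange = solve-∀

    -- The vector (d , 1) is isotropic for Q(y) − a x² with a = Q(d), a form whose zeros are easy to count.
    -- Since x = (B y d − c) / 2a on the c-th coset of the hyperplane orthogonal to (d , 1), the zeros there
    -- are the y with disc c y ≈ 0, and E c is their number.
    module Nonsingular (Qd≉0 : ¬ (Q d ≈ 0#)) where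

      a a2 a4 : Carrier
      a  = Q d
      a2 = a ⊕ a
      a4 = a2 ⊕ a2

      x⊕x≉0 : ∀ {x} → ¬ (x ≈ 0#) → ¬ (x ⊕ x ≈ 0#)
      x⊕x≉0 x≉0 eq = ⊗-≉0 2≉0 x≉0 (≈-trans (≈-sym (x⊕x≈2x _)) eq)

      a2≉0 : ¬ (a2 ≈ 0#)
      a2≉0 = x⊕x≉0 Qd≉0

      a4≉0 : ¬ (a4 ≈ 0#)
      a4≉0 = x⊕x≉0 a2≉0

      a2∈F : ∈F a2
      a2∈F = ⊕∈F (Q∈F d) (Q∈F d)

      a4∈F : ∈F a4
      a4∈F = ⊕∈F a2∈F a2∈F

      -- This is 4a (Q(y) - a x²) at x = (B(y,d) - c) / 2a; the factor 4a clears the denominators.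
      disc : Carrier → Carrier → Carrier
      disc c y = a4 ⊗ Q y ⊕ ⊖ ((B y d ⊕ ⊖ c) ⊗ (B y d ⊕ ⊖ c))

      disc-cong : ∀ {c c′ y y′} → c ≈ c′ → y ≈ y′ → disc c y ≈ disc c′ y′
      disc-cong c≈c′ y≈y′ = ⊕-cong (⊗-congˡ (Q-cong y≈y′)) (⊖-cong (⊗-cong b≈ b≈))
        where b≈ = ⊕-cong (B-cong y≈y′ ≈-refl) (⊖-cong c≈c′)

      disc∈F : ∀ {c} → ∈F c → ∀ y → ∈F (disc c y)
      disc∈F c∈F y = ⊕∈F (⊗∈F a4∈F (Q∈F y)) (⊖∈F (⊗∈F b∈F b∈F))
        where b∈F = ⊕∈F (B∈F y d) (⊖∈F c∈F)

      B-shift-d : ∀ {l} → ∈F l → ∀ y → B (y ⊕ l ⊗ d) d ≈ B y d ⊕ l ⊗ a2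
      B-shift-d l∈F y = ≈-trans (B-shift l∈F y d d) (⊕-congˡ (⊗-congˡ (B-self d)))

      -- Replacing y by y + l d raises x by l, so this is translation by l (d , 1). That vector is
      -- isotropic, and its polar product with the point (y , x) is c, so only a term linear in l
      -- remains.
      disc-shift : ∀ {l} → ∈F l → ∀ c y → disc c (y ⊕ l ⊗ d) ≈ disc c y ⊕ (a4 ⊗ l) ⊗ c
      disc-shift {l} l∈F c y = begin
        a4 ⊗ Q (y ⊕ l ⊗ d) ⊕ ⊖ (b′ ⊗ b′)
          ≈⟨ ⊕-cong Q-part (⊖-cong B-part) ⟩
        ((a4 ⊗ Q y ⊕ (a4 ⊗ l) ⊗ c) ⊕ Y) ⊕ ⊖ (b ⊗ b ⊕ Y)
          ≈⟨ ⊕-congˡ (⊖-⊕-comm (b ⊗ b) Y) ⟨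
        ((a4 ⊗ Q y ⊕ (a4 ⊗ l) ⊗ c) ⊕ Y) ⊕ (⊖ (b ⊗ b) ⊕ ⊖ Y)
          ≈⟨ solve 5 (λ x z y n y′ → ((x :+ z) :+ y) :+ (n :+ y′) := ((x :+ n) :+ z) :+ (y :+ y′)) ≈-refl
               (a4 ⊗ Q y) ((a4 ⊗ l) ⊗ c) Y (⊖ (b ⊗ b)) (⊖ Y) ⟩
        (disc c y ⊕ (a4 ⊗ l) ⊗ c) ⊕ (Y ⊕ ⊖ Y)
          ≈⟨ ≈-trans (⊕-congˡ (⊖-inverseʳ Y)) (⊕-identityʳ _) ⟩
        disc c y ⊕ (a4 ⊗ l) ⊗ c ∎
        where
        open ≈-Reasoning
        b b′ Y : Carrier
        b  = B y d ⊕ ⊖ c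
        b′ = B (y ⊕ l ⊗ d) d ⊕ ⊖ c
        -- The increment common to 4a Q(y) and the square; it cancels in the difference, leaving 4a
        -- l c.
        Y  = (a4 ⊗ l) ⊗ b ⊕ (l ⊗ l) ⊗ (a2 ⊗ a2)
        Q-part : a4 ⊗ Q (y ⊕ l ⊗ d) ≈ (a4 ⊗ Q y ⊕ (a4 ⊗ l) ⊗ c) ⊕ Y
        Q-part = begin
          a4 ⊗ Q (y ⊕ l ⊗ d)
            ≈⟨ ⊗-congˡ (≈-trans (Q-shift l∈F y d) (⊕-congʳ (⊕-congˡ (⊗-congˡ (≈-sym (⊖⊕-cancel (B y d) c)))))) ⟩
          a4 ⊗ ((Q y ⊕ l ⊗ (b ⊕ c)) ⊕ (l ⊗ l) ⊗ a)
            ≈⟨ solve 5 (λ a l b c q → ((a :+ a) :+ (a :+ a)) :* ((q :+ l :* (b :+ c)) :+ (l :* l) :* a)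
                 := (((a :+ a) :+ (a :+ a)) :* q :+ (((a :+ a) :+ (a :+ a)) :* l) :* c)
                    :+ ((((a :+ a) :+ (a :+ a)) :* l) :* b :+ (l :* l) :* ((a :+ a) :* (a :+ a))))
                 ≈-refl a l b c (Q y) ⟩
          (a4 ⊗ Q y ⊕ (a4 ⊗ l) ⊗ c) ⊕ Y ∎
        B-part : b′ ⊗ b′ ≈ b ⊗ b ⊕ Y
        B-part = begin
          b′ ⊗ b′
            ≈⟨ ⊗-cong b′≈ b′≈ ⟩
          (b ⊕ l ⊗ a2) ⊗ (b ⊕ l ⊗ a2)
            ≈⟨ solve 3 (λ a l b → (b :+ l :* (a :+ a)) :* (b :+ l :* (a :+ a))
                 := b :* b :+ ((((a :+ a) :+ (a :+ a)) :* l) :* b :+ (l :* l) :* ((a :+ a) :* (a :+ a)))) ≈-refl a l b ⟩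
          b ⊗ b ⊕ Y ∎
          where
          b′≈ : b′ ≈ b ⊕ l ⊗ a2
          b′≈ = ≈-trans (⊕-congʳ (B-shift-d l∈F y))
            (solve 3 (λ x y z → (x :+ y) :+ z := (x :+ z) :+ y) ≈-refl (B y d) (l ⊗ a2) (⊖ c))

      E : Carrier → ℕ
      E c = ∑ (λ y → δ (disc c y) 0#)

      E-cong : Congruent E
      E-cong c≈c′ = ∑-cong (λ y → δ-congʳ (disc-cong c≈c′ (≈-refl {y})))

      -- For c ≠ 0 the step along d can be normalised by 1 / (4ac), which makes `disc c`
      -- equidistributed over all y.
      E≡-nonzero : ∀ c → ∈F c → ¬ (c ≈ 0#) → E c ≡ p * (P * P)
      E≡-nonzero c c∈F c≉0 = *-cancelˡ-≡ _ _ p (begin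
        p * E c               ≡⟨ cong (p *_) (1*∑ (λ y → δ (disc c y) 0#)) ⟨
        p * W.fibre 0#        ≡⟨ W.Shift.p*fibre (k ⊗ d) (λ _ _ _ → refl) (λ l l∈F y _ → shift l l∈F y) 0∈F ⟩
        ∑ (λ _ → 1)           ≡⟨ trans ∑-one p^[2m]≡ ⟩
        p * (p * (P * P))     ∎)
        where
        open ≡-Reasoning
        module W = Weighted (λ _ → 1) (λ _ → refl) (disc c) (disc-cong ≈-refl) (λ y _ → disc∈F c∈F y)
        k : Carrier
        k = proj₁ (inverse (a4 ⊗ c) (⊗-≉0 a4≉0 c≉0))
        a4ck≈1 : (a4 ⊗ c) ⊗ k ≈ 1#
        a4ck≈1 = proj₂ (inverse (a4 ⊗ c) (⊗-≉0 a4≉0 c≉0))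
        k∈F : ∈F k
        k∈F = inverse∈F (⊗∈F a4∈F c∈F) a4ck≈1 (⊗-≉0 a4≉0 c≉0)
        shift : ∀ l → ∈F l → ∀ y → disc c (y ⊕ l ⊗ (k ⊗ d)) ≈ disc c y ⊕ l
        shift l l∈F y = R.begin
          disc c (y ⊕ l ⊗ (k ⊗ d))            R.≈⟨ disc-cong ≈-refl (⊕-congˡ (≈-sym (⊗-assoc l k d))) ⟩
          disc c (y ⊕ (l ⊗ k) ⊗ d)            R.≈⟨ disc-shift (⊗∈F l∈F k∈F) c y ⟩
          disc c y ⊕ (a4 ⊗ (l ⊗ k)) ⊗ c
            R.≈⟨ ⊕-congˡ (solve 4 (λ a l k c → (a :* (l :* k)) :* c := l :* ((a :* c) :* k)) ≈-refl a4 l k c) ⟩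
          disc c y ⊕ l ⊗ ((a4 ⊗ c) ⊗ k)       R.≈⟨ ⊕-congˡ (≈-trans (⊗-congˡ a4ck≈1) (⊗-identityʳ l)) ⟩
          disc c y ⊕ l                        R.∎
          where module R = ≈-Reasoning

      private
        module ByQ = Weighted (λ _ → 1) (λ _ → refl) (λ y → a4 ⊗ Q y) (λ e → ⊗-congˡ (Q-cong e)) (λ y _ → ⊗∈F a4∈F (Q∈F y))

        V : Carrier → ℕ
        V c = ByQ.fibre c

        -- The scaling factor is an element of norm c; a factor from GF(p) would relate only values
        -- that differ by a square.
        V-const : ∀ c → ∈F c → ¬ (c ≈ 0#) → V c ≡ V 1#
        V-const c c∈F c≉0 = begin
          ∑ (λ y → 1 * δ (a4 ⊗ Q y) c)
            ≡⟨ ∑-scale v≉0 (λ e → cong (1 *_) (δ-congʳ (⊗-congˡ (Q-cong e)))) ⟨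
          ∑ (λ y → 1 * δ (a4 ⊗ Q (v ⊗ y)) c)
            ≡⟨ ∑-cong (λ y → cong (1 *_) (δ-⇔
                 (λ e → ⊗-cancelˡ c≉0 (≈-trans (≈-sym (scaled y)) (≈-trans e (≈-sym (⊗-identityʳ c)))))
                 (λ e → ≈-trans (scaled y) (≈-trans (⊗-congˡ e) (⊗-identityʳ c))))) ⟩
          ∑ (λ y → 1 * δ (a4 ⊗ Q y) 1#) ∎
          where
          open ≡-Reasoning
          v : Carrier
          v = proj₁ (Nm-surjective c∈F c≉0)
          Nv≈c : Nm v ≈ c
          Nv≈c = proj₂ (Nm-surjective c∈F c≉0)
          v≉0 : ¬ (v ≈ 0#)
          v≉0 v≈0 = c≉0 (≈-trans (≈-sym Nv≈c) (≈-trans (↑-congˡ u v≈0) (0↑ u (m≤n+m 1 (p ^ m)))))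
          scaled : ∀ y → a4 ⊗ Q (v ⊗ y) ≈ c ⊗ (a4 ⊗ Q y)
          scaled y = ≈-trans (⊗-congˡ (Q-Nm-⊗ c∈F Nv≈c y))
            (solve 3 (λ a c q → a :* (c :* q) := c :* (a :* q)) ≈-refl a4 c (Q y))

        V-total : V 0# + s * V 1# ≡ p * (p * (P * P))
        V-total = trans (sym (∑-F ByQ.fibre-cong V-const)) (trans ByQ.∑-fibre (trans ∑-one p^[2m]≡))

        δ-disc : ∀ c y → δ (disc c y) 0# ≡ δ (a4 ⊗ Q y) ((B y d ⊕ ⊖ c) ⊗ (B y d ⊕ ⊖ c))
        δ-disc c y = δ-⇔
          (λ e → ⊕-cancelʳ _ _ _ (≈-trans e (≈-sym (⊖-inverseʳ _))))
          (λ e → ≈-trans (⊕-congʳ e) (⊖-inverseʳ _))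

        -- For fixed y the involution sending c to B(y,d) - c permutes GF(p). It turns the condition
        -- 4a Q(y) = (B(y,d) - c)² into 4a Q(y) = c², from which B has disappeared.
        reflect : ∀ y {f} → Congruent f → ∑ (λ c → φ c * f (B y d ⊕ ⊖ c)) ≡ ∑ (λ c → φ c * f c)
        reflect y {f} f-cong = begin
          ∑ (λ c → φ c * f (b ⊕ ⊖ c))
            ≡⟨ ∑-cong (λ c → cong (_* f (b ⊕ ⊖ c)) (δ-⇔ {y = c} {y′ = b ⊕ ⊖ c}
                 (λ c∈F → ⊕∈F (B∈F y d) (⊖∈F c∈F))
                 (λ b-c∈F → ∈F-resp (invol c) (⊕∈F (B∈F y d) (⊖∈F b-c∈F))))) ⟩
          ∑ (λ c → φ (b ⊕ ⊖ c) * f (b ⊕ ⊖ c))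
            ≡⟨ ∑-bij (λ c → b ⊕ ⊖ c) (λ c → b ⊕ ⊖ c) (λ e → ⊕-congˡ (⊖-cong e)) (λ e → ⊕-congˡ (⊖-cong e)) invol invol
                 (λ e → cong₂ _*_ (φ-cong e) (f-cong e)) ⟩
          ∑ (λ c → φ c * f c) ∎
          where
          open ≡-Reasoning
          b = B y d
          invol : ∀ c → b ⊕ ⊖ (b ⊕ ⊖ c) ≈ c
          invol c = R.begin
            b ⊕ ⊖ (b ⊕ ⊖ c)         R.≈⟨ ⊕-congˡ (⊖-⊕-comm b (⊖ c)) ⟨
            b ⊕ (⊖ b ⊕ ⊖ (⊖ c))     R.≈⟨ ⊕-assoc b (⊖ b) _ ⟨
            (b ⊕ ⊖ b) ⊕ ⊖ (⊖ c)     R.≈⟨ ⊕-cong (⊖-inverseʳ b) (⊖-involutive c) ⟩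
            0# ⊕ c                  R.≈⟨ ⊕-identityˡ c ⟩
            c                       R.∎
            where module R = ≈-Reasoning

        square : Carrier → ℕ
        square c = ∑ (λ y → δ (a4 ⊗ Q y) (c ⊗ c))

        square-const : ∀ c → ∈F c → ¬ (c ≈ 0#) → square c ≡ V 1#
        square-const c c∈F c≉0 =
          trans (sym (1*∑ (λ y → δ (a4 ⊗ Q y) (c ⊗ c)))) (V-const (c ⊗ c) (⊗∈F c∈F c∈F) (⊗-≉0 c≉0 c≉0))

        -- The zeros of the form in one more variable, counted coset by coset. After `reflect` each
        -- nonzero c contributes the number of y with 4a Q(y) = c², which is `V 1#` because `V` is
        -- constant on all nonzero values. The sum is then that of `V` over GF(p), which is the size
        -- of the field.
        ∑E≡ : ∑ (λ c → φ c * E c) ≡ p * (p * (P * P))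
        ∑E≡ = begin
          ∑ (λ c → φ c * E c)
            ≡⟨ ∑-cong (λ c → ∑-*ˡ (φ c) (λ y → δ (disc c y) 0#)) ⟨
          ∑ (λ c → ∑ (λ y → φ c * δ (disc c y) 0#))
            ≡⟨ ∑-swap (λ c y → φ c * δ (disc c y) 0#) ⟩
          ∑ (λ y → ∑ (λ c → φ c * δ (disc c y) 0#))
            ≡⟨ ∑-cong (λ y → ∑-cong (λ c → cong (φ c *_) (δ-disc c y))) ⟩
          ∑ (λ y → ∑ (λ c → φ c * δ (a4 ⊗ Q y) ((B y d ⊕ ⊖ c) ⊗ (B y d ⊕ ⊖ c))))
            ≡⟨ ∑-cong (λ y → reflect y (λ e → δ-congˡ {a4 ⊗ Q y} (⊗-cong e e))) ⟩
          ∑ (λ y → ∑ (λ c → φ c * δ (a4 ⊗ Q y) (c ⊗ c)))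
            ≡⟨ ∑-swap (λ c y → φ c * δ (a4 ⊗ Q y) (c ⊗ c)) ⟨
          ∑ (λ c → ∑ (λ y → φ c * δ (a4 ⊗ Q y) (c ⊗ c)))
            ≡⟨ ∑-cong (λ c → ∑-*ˡ (φ c) (λ y → δ (a4 ⊗ Q y) (c ⊗ c))) ⟩
          ∑ (λ c → φ c * square c)
            ≡⟨ ∑-F (λ e → ∑-cong (λ y → δ-congˡ {a4 ⊗ Q y} (⊗-cong e e))) square-const ⟩
          square 0# + s * V 1#
            ≡⟨ cong (_+ s * V 1#) (trans (sym (1*∑ (λ y → δ (a4 ⊗ Q y) (0# ⊗ 0#)))) (ByQ.fibre-cong (⊗-zeroˡ 0#))) ⟩
          V 0# + s * V 1#
            ≡⟨ V-total ⟩
          p * (p * (P * P)) ∎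
          where open ≡-Reasoning

      -- For c = 0 translation leaves `disc` unchanged and gives no information, so this count is
      -- obtained by subtracting the others from the total.
      E0≡ : E 0# ≡ p * (P * P)
      E0≡ = +-cancelʳ-≡ (s * (p * (P * P))) _ _ (begin
        E 0# + s * (p * (P * P))            ≡⟨ ∑-F E-cong E≡-nonzero ⟨
        ∑ (λ c → φ c * E c)                 ≡⟨ ∑E≡ ⟩
        p * (p * (P * P))                   ≡⟨ cong (_* (p * (P * P))) p≡1+s ⟩
        p * (P * P) + s * (p * (P * P))     ∎)
        where open ≡-Reasoning

      -- Translation along d preserves `disc 0#` and, normalised by 1 / 2a, raises B(y,d) by l. So a
      -- p-th part of the zeros of `disc 0#` has B(y,d) = 0, and there `disc 0# y` is 4a Q(y).
      N0≡ : N 0# ≡ P * P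
      N0≡ = *-cancelˡ-≡ _ _ p (begin
        p * N 0#           ≡⟨ cong (p *_) (∑-cong pointwise) ⟩
        p * W.fibre 0#     ≡⟨ W.Shift.p*fibre (k ⊗ d) w-shift (λ l l∈F y _ → T-shift l l∈F y) 0∈F ⟩
        E 0#               ≡⟨ E0≡ ⟩
        p * (P * P)        ∎)
        where
        open ≡-Reasoning
        module W = Weighted (λ y → δ (disc 0# y) 0#) (λ x≈y → δ-congʳ (disc-cong ≈-refl x≈y))
                            (λ y → B y d) (λ x≈y → B-cong x≈y ≈-refl) (λ y _ → B∈F y d)
        k : Carrier
        k = proj₁ (inverse a2 a2≉0)
        a2k≈1 : a2 ⊗ k ≈ 1#
        a2k≈1 = proj₂ (inverse a2 a2≉0)
        k∈F : ∈F k
        k∈F = inverse∈F a2∈F a2k≈1 a2≉0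
        w-shift : ∀ l → ∈F l → ∀ y → δ (disc 0# (y ⊕ l ⊗ (k ⊗ d))) 0# ≡ δ (disc 0# y) 0#
        w-shift l l∈F y = δ-congʳ (≈-trans (disc-cong ≈-refl (⊕-congˡ (≈-sym (⊗-assoc l k d))))
          (≈-trans (disc-shift (⊗∈F l∈F k∈F) 0# y) (≈-trans (⊕-congˡ (⊗-zeroʳ _)) (⊕-identityʳ _))))
        T-shift : ∀ l → ∈F l → ∀ y → B (y ⊕ l ⊗ (k ⊗ d)) d ≈ B y d ⊕ l
        T-shift l l∈F y = ≈-trans (B-cong (⊕-congˡ (≈-sym (⊗-assoc l k d))) ≈-refl)
          (≈-trans (B-shift-d (⊗∈F l∈F k∈F) y) (⊕-congˡ
            (≈-trans (⊗-assoc l k a2) (≈-trans (⊗-congˡ (≈-trans (⊗-comm k a2) a2k≈1)) (⊗-identityʳ l)))))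
        pointwise : ∀ y → δ (Q y) 0# * δ (B y d) 0# ≡ δ (disc 0# y) 0# * δ (B y d) 0#
        pointwise y with B y d ≟ 0#
        ... | no  _   = trans (*-zeroʳ (δ (Q y) 0#)) (sym (*-zeroʳ (δ (disc 0# y) 0#)))
        ... | yes B≈0 = cong (_* 1) (trans
          (δ-⇔ (λ e → ≈-trans (⊗-congˡ e) (≈-trans (⊗-zeroʳ a4) (≈-sym bb≈0)))
               (λ e → ⊗-≈0 (≈-trans e bb≈0) a4≉0))
          (sym (δ-disc 0# y)))
          where
          b≈0 : B y d ⊕ ⊖ 0# ≈ 0#
          b≈0 = ≈-trans (⊕-congʳ B≈0) (⊖-inverseʳ 0#)
          bb≈0 : (B y d ⊕ ⊖ 0#) ⊗ (B y d ⊕ ⊖ 0#) ≈ 0#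
          bb≈0 = ≈-trans (⊗-congʳ b≈0) (⊗-zeroˡ _)

      N1+P≡ : N 1# + P ≡ P * P
      N1+P≡ = *-cancelˡ-≡ _ _ s {{>-nonZero (m<n⇒0<n∸m 1<p)}} (+-cancelˡ-≡ (P * P) _ _ (begin
        P * P + s * (N 1# + P)              ≡⟨ rearrange (P * P) s (N 1#) P ⟩
        (P * P + s * N 1#) + P * s          ≡⟨ cong (λ z → (z + s * N 1#) + P * s) N0≡ ⟨
        (N 0# + s * N 1#) + P * s           ≡⟨ cong (_+ P * s) N-total ⟩
        Q-zeros + P * s                     ≡⟨ Q-zeros+P*s≡ ⟩
        p * (P * P)                         ≡⟨ cong (_* (P * P)) p≡1+s ⟩
        P * P + s * (P * P)                 ∎))
        where
        open ≡-Reasoning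
        rearrange : ∀ x s n r → x + s * (n + r) ≡ (x + s * n) + r * s
        rearrange = solve-∀

  -- The partial difference set

  X : Carrier → Bool
  X = inX R F p m α e

  0<e : 0 < e
  0<e = n≢0⇒n>0 (λ e≡0 → <⇒≢ M>0 (trans (cong (_* s) (sym e≡0)) e[p-1]≡p^m-1))

  Nm-↑ : ∀ k → Nm (α ↑ k) ≈ ω ↑ k
  Nm-↑ k = ↑-*′ α k u

  ωᵉ∈F : ∀ k → ∈F (ω ↑ (e * k))
  ωᵉ∈F k = ∈F-resp (≈-trans (↑-congʳ α (rearrange k e u)) (≈-sym (↑-* α u (e * k))))
                   (≈-trans (↑-congʳ (α ↑ (k * (e * u))) p≡1+s) (𝔽.↑*-fixed k))
    where
    rearrange : ∀ k e u → k * (e * u) ≡ u * (e * k)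
    rearrange = solve-∀

  -- The norm of α^(e k) is a power of ω^e and so lies in GF(p), where it comes out of the trace.
  -- Whether Q vanishes thus depends only on the exponent modulo e, and X is a union of cyclotomic
  -- classes.
  Q-α^ : ∀ j k → Q (α ↑ (j + e * k)) ≈ ω ↑ (e * k) ⊗ Tr (ω ↑ j)
  Q-α^ j k = ≈-trans
    (Tr-cong (≈-trans (Nm-↑ (j + e * k)) (≈-trans (↑-+ ω j (e * k)) (⊗-comm _ _))))
    (Tr-⊗ (ωᵉ∈F k) (ω ↑ j))

  X⇔ : ∀ x → (X x ≡ true) ⇔ ((¬ x ≈ 0#) × Q x ≈ 0#)
  X⇔ x = mk⇔ to from
    where
    to : X x ≡ true → (¬ x ≈ 0#) × Q x ≈ 0#
    to x∈X with j , j<e , both ← anyBelow⁻ e _ x∈X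
      with j∈D , class ← ∧-true both
      with k , _ , hit ← anyBelow⁻ n _ class
      with x≈ ← does-true (x ≟ (α ↑ (j + e * k))) hit =
        (λ x≈0 → ↑-≉0 (j + e * k) α≉0 (≈-trans (≈-sym x≈) x≈0)) ,
        ≈-trans (Q-cong x≈) (≈-trans (Q-α^ j k)
          (≈-trans (⊗-congˡ (does-true (Tr (ω ↑ j) ≟ 0#) j∈D)) (⊗-zeroʳ _)))
    from : (¬ x ≈ 0#) × Q x ≈ 0# → X x ≡ true
    from (x≉0 , Qx≈0) with log x x≉0
    -- Division of the logarithm by e gives the class and the position in it. The quotient does not
    -- exceed the logarithm, which keeps it below the search bound n.
    ... | l , αˡ≈x = anyBelow⁺ e _ (m%n<n i e) (cong₂ _∧_ j∈D
      (anyBelow⁺ n (λ k → does (x ≟ (α ↑ (i % e + e * k)))) (≤-<-trans (m/n≤m i e) (toℕ<n l)) (dec-true (x ≟ _) x≈)))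
      where
      instance _ = >-nonZero 0<e
      i = toℕ l
      i≡ : i ≡ i % e + e * (i / e)
      i≡ = trans (m≡m%n+[m/n]*n i e) (cong (i % e +_) (*-comm (i / e) e))
      x≈ : x ≈ α ↑ (i % e + e * (i / e))
      x≈ = ≈-trans (≈-sym αˡ≈x) (↑-congʳ α i≡)
      j∈D : does (Tr (ω ↑ (i % e)) ≟ 0#) ≡ true
      j∈D = dec-true (Tr (ω ↑ (i % e)) ≟ 0#) (⊗-≈0
        (≈-trans (≈-sym (Q-α^ (i % e) (i / e))) (≈-trans (Q-cong (≈-sym x≈)) Qx≈0))
        (↑-≉0 (e * (i / e)) (↑-≉0 u α≉0)))

  χ : Carrier → ℕ
  χ x = ⟦ X x ⟧

  X-cong : ∀ {x y} → (x ≈ 0# → y ≈ 0#) → (y ≈ 0# → x ≈ 0#) → Q x ≈ Q y → X x ≡ X y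
  X-cong {x} {y} x→y y→x Qx≈Qy = ⇔→≡ {z = true} (mk⇔
    (λ x∈X → let x≉0 , Qx = to (X⇔ x) x∈X in from (X⇔ y) ((λ y≈0 → x≉0 (y→x y≈0)) , ≈-trans (≈-sym Qx≈Qy) Qx))
    (λ y∈X → let y≉0 , Qy = to (X⇔ y) y∈X in from (X⇔ x) ((λ x≈0 → y≉0 (x→y x≈0)) , ≈-trans Qx≈Qy Qy)))
    where open Equivalence

  χ-cong : Congruent χ
  χ-cong x≈y = cong ⟦_⟧ (X-cong (≈-trans (≈-sym x≈y)) (≈-trans x≈y) (Q-cong x≈y))

  X-0 : ∀ {x} → x ≈ 0# → X x ≡ false
  X-0 {x} x≈0 with X x in eq
  ... | false = refl
  ... | true  = contradiction x≈0 (proj₁ (Equivalence.to (X⇔ x) eq))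

  χ-≉0 : ∀ {x} → ¬ (x ≈ 0#) → χ x ≡ δ (Q x) 0#
  χ-≉0 {x} x≉0 = cong ⟦_⟧ (⇔→≡ {z = true} (mk⇔
    (λ x∈X → dec-true (Q x ≟ 0#) (proj₂ (Equivalence.to (X⇔ x) x∈X)))
    (λ Qx → Equivalence.from (X⇔ x) (x≉0 , does-true (Q x ≟ 0#) Qx))))

  χ-0 : ∀ {x} → x ≈ 0# → χ x ≡ 0
  χ-0 x≈0 = cong ⟦_⟧ (X-0 x≈0)

  -- The added 1 is the zero at 0, which X excludes.
  size+1≡ : size R F X + 1 ≡ Q-zeros
  size+1≡ = begin
    size R F X + 1                    ≡⟨ cong₂ _+_ (countFin≡sum (λ i → X (enum i))) (sym (∑-δ₁ 0#)) ⟩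
    ∑ χ + ∑ (λ x → δ x 0#)            ≡⟨ ∑-+ χ (λ x → δ x 0#) ⟨
    ∑ (λ x → χ x + δ x 0#)            ≡⟨ ∑-cong pointwise ⟩
    Q-zeros                           ∎
    where
    open ≡-Reasoning
    pointwise : ∀ x → χ x + δ x 0# ≡ δ (Q x) 0#
    pointwise x with x ≟ 0#
    ... | yes x≈0 = trans (cong (_+ 1) (χ-0 x≈0)) (sym (δ-yes (≈-trans (Q-cong x≈0) Q-0)))
    ... | no  x≉0 = trans (+-identityʳ (χ x)) (χ-≉0 x≉0)

  ⊖1∈F : ∈F (⊖ 1#)
  ⊖1∈F = ⊖∈F 1∈F

  Q-⊖ : ∀ x → Q (⊖ x) ≈ Q x
  Q-⊖ x = begin
    Q (⊖ x)                       ≈⟨ Q-cong (≈-sym (⊖1⊗ x)) ⟩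
    Q (⊖ 1# ⊗ x)                  ≈⟨ Q-⊗ ⊖1∈F x ⟩
    (⊖ 1# ⊗ ⊖ 1#) ⊗ Q x           ≈⟨ ⊗-congʳ (≈-trans (⊖1⊗ (⊖ 1#)) (⊖-involutive 1#)) ⟩
    1# ⊗ Q x                      ≈⟨ ⊗-identityˡ _ ⟩
    Q x                           ∎
    where open ≈-Reasoning

  X-⊖ : ∀ x → X (⊖ x) ≡ X x
  X-⊖ x = X-cong
    (λ -x≈0 → ≈-trans (≈-sym (⊖-involutive x)) (≈-trans (⊖-cong -x≈0) ⊖0≈0))
    (λ x≈0 → ≈-trans (⊖-cong x≈0) ⊖0≈0)
    (Q-⊖ x)

  -- Differences as zeros on a hyperplane

  diffCount≡ : ∀ d → diffCount R F X d ≡ ∑ (λ y → χ (y ⊕ d) * χ y)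
  diffCount≡ d = begin
    diffCount R F X d
      ≡⟨ sumFin≡sum (λ i → countFin (λ j → X (enum i) ∧ X (enum j) ∧ does ((enum i ⊕ ⊖ enum j) ≟ d))) ⟩
    sum (λ i → countFin (λ j → X (enum i) ∧ X (enum j) ∧ does ((enum i ⊕ ⊖ enum j) ≟ d)))
      ≡⟨ sum-cong-≗ (λ i → countFin≡sum (λ j → X (enum i) ∧ X (enum j) ∧ does ((enum i ⊕ ⊖ enum j) ≟ d))) ⟩
    ∑ (λ x → ∑ (λ y → ⟦ X x ∧ X y ∧ does ((x ⊕ ⊖ y) ≟ d) ⟧))
      ≡⟨ ∑-cong (λ x → ∑-cong (λ y → pair x y)) ⟩
    ∑ (λ x → ∑ (λ y → δ x (y ⊕ d) * (χ x * χ y)))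
      ≡⟨ ∑-swap (λ x y → δ x (y ⊕ d) * (χ x * χ y)) ⟩
    ∑ (λ y → ∑ (λ x → δ x (y ⊕ d) * (χ x * χ y)))
      ≡⟨ ∑-cong (λ y → ∑-δ (y ⊕ d) (λ e → cong (_* χ y) (χ-cong e))) ⟩
    ∑ (λ y → χ (y ⊕ d) * χ y) ∎
    where
    open ≡-Reasoning
    rearrange : ∀ a b c → a * (b * c) ≡ c * (a * b)
    rearrange = solve-∀
    pair : ∀ x y → ⟦ X x ∧ X y ∧ does ((x ⊕ ⊖ y) ≟ d) ⟧ ≡ δ x (y ⊕ d) * (χ x * χ y)
    pair x y = begin
      ⟦ X x ∧ X y ∧ does ((x ⊕ ⊖ y) ≟ d) ⟧
        ≡⟨ trans (⟦∧⟧ (X x) _) (cong (χ x *_) (⟦∧⟧ (X y) _)) ⟩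
      χ x * (χ y * δ (x ⊕ ⊖ y) d)
        ≡⟨ rearrange (χ x) (χ y) _ ⟩
      δ (x ⊕ ⊖ y) d * (χ x * χ y)
        ≡⟨ cong (_* (χ x * χ y)) (δ-⇔
             (λ e → ≈-trans (≈-sym (⊖⊕-cancel x y)) (≈-trans (⊕-congʳ e) (⊕-comm d y)))
             (λ e → ≈-trans (⊕-congʳ (≈-trans e (⊕-comm y d))) (⊕⊖-cancel d y))) ⟩
      δ x (y ⊕ d) * (χ x * χ y) ∎

  module Difference (d : Carrier) (d≉0 : ¬ (d ≈ 0#)) where
    open Direction d d≉0

    Q-⊕-zero : ∀ {y} → Q y ≈ 0# → Q (y ⊕ d) ≈ B y d ⊕ Q d
    Q-⊕-zero Qy≈0 = ≈-trans (Q-⊕ _ d) (⊕-congʳ (≈-trans (⊕-congʳ Qy≈0) (⊕-identityˡ _)))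

    ≈⊖ : ∀ {y} → y ⊕ d ≈ 0# → y ≈ ⊖ d
    ≈⊖ {y} e = ≈-trans (≈-sym (⊕⊖-cancel y d)) (≈-trans (⊕-congʳ e) (⊕-identityˡ _))

    ⊖≈ : ∀ {y} → y ≈ ⊖ d → y ⊕ d ≈ 0#
    ⊖≈ e = ≈-trans (⊕-congʳ e) (⊖-inverseˡ d)

    -- The 2 accounts for y = 0 and y = -d, which are distinct because d ≠ 0. Both satisfy Q(y) = 0
    -- and B(y,d) = 0, but one of y and y + d is then 0 and not in X.
    diff-inside : Q d ≈ 0# → diffCount R F X d + 2 ≡ N 0#
    diff-inside Qd≈0 = begin
      diffCount R F X d + 2
        ≡⟨ cong₂ _+_ (diffCount≡ d) (sym (cong₂ _+_ (∑-δ₁ 0#) (∑-δ₁ (⊖ d)))) ⟩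
      ∑ (λ y → χ (y ⊕ d) * χ y) + (∑ (λ y → δ y 0#) + ∑ (λ y → δ y (⊖ d)))
        ≡⟨ cong (∑ (λ y → χ (y ⊕ d) * χ y) +_) (∑-+ (λ y → δ y 0#) (λ y → δ y (⊖ d))) ⟨
      ∑ (λ y → χ (y ⊕ d) * χ y) + ∑ (λ y → δ y 0# + δ y (⊖ d))
        ≡⟨ ∑-+ (λ y → χ (y ⊕ d) * χ y) (λ y → δ y 0# + δ y (⊖ d)) ⟨
      ∑ (λ y → χ (y ⊕ d) * χ y + (δ y 0# + δ y (⊖ d)))
        ≡⟨ ∑-cong pointwise ⟩
      N 0# ∎
      where
      open ≡-Reasoning
      Q-⊖d : Q (⊖ d) ≈ 0#
      Q-⊖d = ≈-trans (Q-⊖ d) Qd≈0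
      Q-sum : ∀ {y} → Q y ≈ 0# → Q (y ⊕ d) ≈ B y d
      Q-sum Qy≈0 = ≈-trans (Q-⊕-zero Qy≈0) (≈-trans (⊕-congˡ Qd≈0) (⊕-identityʳ _))
      pointwise : ∀ y → χ (y ⊕ d) * χ y + (δ y 0# + δ y (⊖ d)) ≡ δ (Q y) 0# * δ (B y d) 0#
      pointwise y with y ≟ 0# | y ≟ (⊖ d)
      ... | yes y≈0 | yes y≈-d = contradiction
              (≈-trans (≈-sym (⊖-involutive d)) (≈-trans (⊖-cong (≈-trans (≈-sym y≈-d) y≈0)) ⊖0≈0)) d≉0
      ... | yes y≈0 | no  _    = trans
              (cong (λ z → χ (y ⊕ d) * z + 1) (χ-0 y≈0))
              (trans (cong (_+ 1) (*-zeroʳ (χ (y ⊕ d))))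
                (sym (cong₂ _*_ (δ-yes (≈-trans (Q-cong y≈0) Q-0)) (δ-yes (≈-trans (B-cong y≈0 ≈-refl) (B-0ˡ d))))))
      ... | no  _   | yes y≈-d = trans
              (cong (λ z → z * χ y + 1) (χ-0 (⊖≈ y≈-d)))
              (sym (cong₂ _*_ (δ-yes Qy≈0)
                (δ-yes (≈-trans (≈-sym (Q-sum Qy≈0)) (≈-trans (Q-cong (⊖≈ y≈-d)) Q-0)))))
              where
              Qy≈0 : Q y ≈ 0#
              Qy≈0 = ≈-trans (Q-cong y≈-d) Q-⊖d
      ... | no  y≉0 | no  y≉-d = trans (+-identityʳ _) (trans
              (cong₂ _*_ (χ-≉0 (λ e → y≉-d (≈⊖ e))) (χ-≉0 y≉0)) (trans (*-comm (δ (Q (y ⊕ d)) 0#) _) shift))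
              where
              shift : δ (Q y) 0# * δ (Q (y ⊕ d)) 0# ≡ δ (Q y) 0# * δ (B y d) 0#
              shift with Q y ≟ 0#
              ... | yes Qy≈0 = cong (1 *_) (δ-congʳ (Q-sum Qy≈0))
              ... | no  _    = refl

    -- No correction arises: at y = 0 the value of B is 0 and not -Q(d), and at y = -d the form is
    -- Q(d) ≠ 0, so `N (⊖ Q d)` counts neither point.
    diff-outside : ¬ (Q d ≈ 0#) → diffCount R F X d ≡ N (⊖ Q d)
    diff-outside Qd≉0 = trans (diffCount≡ d) (∑-cong pointwise)
      where
      pointwise : ∀ y → χ (y ⊕ d) * χ y ≡ δ (Q y) 0# * δ (B y d) (⊖ Q d)
      pointwise y with y ≟ 0# | y ≟ (⊖ d)
      ... | yes y≈0 | _        = trans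
              (trans (cong (χ (y ⊕ d) *_) (χ-0 y≈0)) (*-zeroʳ (χ (y ⊕ d))))
              (sym (trans (cong (δ (Q y) 0# *_) (δ-no (λ B≈-Qd → Qd≉0 (≈-trans (≈-sym (⊖-involutive _))
                (≈-trans (⊖-cong (≈-trans (≈-sym B≈-Qd) (≈-trans (B-cong y≈0 ≈-refl) (B-0ˡ d)))) ⊖0≈0)))))
                (*-zeroʳ (δ (Q y) 0#))))
      ... | no  _   | yes y≈-d = trans
              (cong (_* χ y) (χ-0 (⊖≈ y≈-d)))
              (sym (cong (_* δ (B y d) (⊖ Q d)) (δ-no (λ Qy≈0 → Qd≉0
                (≈-trans (≈-sym (Q-⊖ d)) (≈-trans (Q-cong (≈-sym y≈-d)) Qy≈0))))))
      ... | no  y≉0 | no  y≉-d = trans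
              (cong₂ _*_ (χ-≉0 (λ e → y≉-d (≈⊖ e))) (χ-≉0 y≉0)) (trans (*-comm (δ (Q (y ⊕ d)) 0#) _) shift)
              where
              shift : δ (Q y) 0# * δ (Q (y ⊕ d)) 0# ≡ δ (Q y) 0# * δ (B y d) (⊖ Q d)
              shift with Q y ≟ 0#
              ... | no  _    = refl
              ... | yes Qy≈0 = cong (1 *_) (δ-⇔
                      (λ e → ⊕-cancelʳ (Q d) _ _ (≈-trans (≈-sym (Q-⊕-zero Qy≈0)) (≈-trans e (≈-sym (⊖-inverseˡ _)))))
                      (λ e → ≈-trans (Q-⊕-zero Qy≈0) (≈-trans (⊕-congʳ e) (⊖-inverseˡ _))))

    λ-count : X d ≡ true → diffCount R F X d ≡ p ^ (2 * m ∸ 2) ∸ P * s ∸ 2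
    λ-count d∈X = begin
      diffCount R F X d                       ≡⟨ m+n∸n≡m _ 2 ⟨
      diffCount R F X d + 2 ∸ 2               ≡⟨ cong (_∸ 2) (diff-inside Qd≈0) ⟩
      N 0# ∸ 2                                ≡⟨ cong (_∸ 2) (m+n∸n≡m _ (P * s)) ⟨
      N 0# + P * s ∸ P * s ∸ 2                ≡⟨ cong (λ z → z ∸ P * s ∸ 2) (trans (Singular.N0+P*s≡ Qd≈0) (sym p^[2m-2]≡)) ⟩
      p ^ (2 * m ∸ 2) ∸ P * s ∸ 2             ∎
      where
      open ≡-Reasoning
      Qd≈0 = proj₂ (Equivalence.to (X⇔ d) d∈X)

    μ-count : X d ≡ false → diffCount R F X d ≡ p ^ (2 * m ∸ 2) ∸ P
    μ-count d∉X = begin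
      diffCount R F X d                       ≡⟨ diff-outside Qd≉0 ⟩
      N (⊖ Q d)                               ≡⟨ N-const (⊖ Q d) (⊖∈F (Q∈F d)) ⊖Qd≉0 ⟩
      N 1#                                    ≡⟨ m+n∸n≡m _ P ⟨
      N 1# + P ∸ P                            ≡⟨ cong (_∸ P) (trans (Nonsingular.N1+P≡ Qd≉0) (sym p^[2m-2]≡)) ⟩
      p ^ (2 * m ∸ 2) ∸ P                     ∎
      where
      open ≡-Reasoning
      Qd≉0 : ¬ (Q d ≈ 0#)
      Qd≉0 Qd≈0 = contradiction (trans (sym d∉X) (Equivalence.from (X⇔ d) (d≉0 , Qd≈0))) λ ()
      ⊖Qd≉0 : ¬ (⊖ Q d ≈ 0#)
      ⊖Qd≉0 e = Qd≉0 (≈-trans (≈-sym (⊖-involutive _)) (≈-trans (⊖-cong e) ⊖0≈0))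

  size≡ : size R F X ≡ p ^ (2 * m ∸ 1) ∸ P * s ∸ 1
  size≡ = begin
    size R F X                              ≡⟨ m+n∸n≡m _ 1 ⟨
    size R F X + 1 ∸ 1                      ≡⟨ cong (_∸ 1) size+1≡ ⟩
    Q-zeros ∸ 1                             ≡⟨ cong (_∸ 1) (m+n∸n≡m _ (P * s)) ⟨
    Q-zeros + P * s ∸ P * s ∸ 1             ≡⟨ cong (λ z → z ∸ P * s ∸ 1) (trans Q-zeros+P*s≡ (sym p^[2m-1]≡)) ⟩
    p ^ (2 * m ∸ 1) ∸ P * s ∸ 1             ∎
    where open ≡-Reasoning

  regular-PDS : IsRegularPDS R F X (p ^ (2 * m)) (p ^ (2 * m ∸ 1) ∸ P * s ∸ 1)
                  (p ^ (2 * m ∸ 2) ∸ P * s ∸ 2) (p ^ (2 * m ∸ 2) ∸ P)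
  regular-PDS = refl , size≡ , Difference.λ-count , Difference.μ-count , X-⊖ , X-0 ≈-refl

theorem3p4 : (p m : ℕ) → Prime p → p % 2 ≡ 1 → 1 < m →
    (R : CommutativeRing 0ℓ 0ℓ) → (F : IsFiniteFieldOfOrder R (p ^ (2 * m))) →
    (α : CommutativeRing.Carrier R) → IsPrimitive R (p ^ (2 * m)) α →
    (e : ℕ) → e * (p ∸ 1) ≡ p ^ m ∸ 1 →
    IsRegularPDS R F (inX R F p m α e) (p ^ (2 * m))
    (p ^ (2 * m ∸ 1) ∸ p ^ (m ∸ 1) * (p ∸ 1) ∸ 1)
    (p ^ (2 * m ∸ 2) ∸ p ^ (m ∸ 1) * (p ∸ 1) ∸ 2)
    (p ^ (2 * m ∸ 2) ∸ p ^ (m ∸ 1))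
    × (∀ x → (inX R F p m α e x ≡ true)
    ⇔ ((¬ CommutativeRing._≈_ R x (CommutativeRing.0# R))
    × CommutativeRing._≈_ R (trace R p m (pow R x (p ^ m + 1))) (CommutativeRing.0# R)))
theorem3p4 p m p-prime p-odd 1<m R F α α-prim e e[p-1]≡p^m-1 = regular-PDS , X⇔
  where open Theorem p m p-prime p-odd 1<m R F α α-prim e e[p-1]≡p^m-1
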